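{- Let $\overrightarrow{W}$ be a Morse sequence on a simplicial complex $K$. Then for every $p$: (1) the homology spaces $H_p(K)$ and $H_p(\widehat W)$ are isomorphic vector spaces over $\mathbb{Z}_2$; (2) the cohomology spaces $H^p(K)$ and $H^p(\widehat W)$ are isomorphic vector spaces over $\mathbb{Z}_2$.
   Context: A simplicial complex $K$ is a finite collection of non-empty finite sets closed under taking non-empty subsets; $\dim\sigma=|\sigma|-1$, $K^{(p)}$ the set of $p$-simplices. A pair $(\sigma,\tau)$ with $\sigma\subsetneq\tau$ is a free pair for $K$ if $\tau$ is the only simplex other than $\sigma$ containing $\sigma$; $K$ is then an elementary expansion of $K\setminus\{\sigma,\tau\}$. If $\nu$ is a facet (maximal simplex) of $K$, $K$ is an elementary filling of $K\setminus\{\nu\}$. A Morse sequence on $K$ is a sequence $\langle\emptyset=K_0,\dots,K_k=K\rangle$ with each $K_i$ an elementary expansion or filling of $K_{i-1}$; simplices added by fillings are critical; for an expansion $K_i=K_{i-1}\cup\{\sigma,\tau\}$, $\sigma\subset\tau$, $\sigma$ is lower regular and $\tau$ upper regular. $\widehat W$ is the set of critical simplices. $K[p]$ is the $\mathbb{Z}_2$-vector space of subsets of $K^{(p)}$ (sum = symmetric difference, $0=\emptyset$), $\widehat W[p]=\{c\in K[p]:c\subseteq\widehat W\}$. For $\sigma\in K^{(p)}$, $\partial(\sigma)=\{\tau\in K^{(p-1)}:\tau\subset\sigma\}$, $\delta(\sigma)=\{\tau\in K^{(p+1)}:\sigma\subset\tau\}$, with linear extensions $\partial_p,\delta_p$;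 $H_p(K)=\ker\partial_p/\operatorname{im}\partial_{p+1}$ and $H^p(K)=\ker\delta_p/\operatorname{im}\delta_{p-1}$ (mod 2 simplicial homology and cohomology). The reference map $\curlywedge$ is the unique map assigning to each $p$-simplex an element of $\widehat W[p]$, extended linearly, with $\curlywedge(\nu)=\{\nu\}$ for critical $\nu$ and $\curlywedge(\tau)=0=\curlywedge(\partial(\tau))$ for upper regular $\tau$; the coreference map $\curlyvee$ is the unique such map with $\curlyvee(\nu)=\{\nu\}$ for critical $\nu$ and $\curlyvee(\sigma)=0=\curlyvee(\delta(\sigma))$ for lower regular $\sigma$. The critical complex is the chain complex $(\widehat W[p],\widehat\partial_p)$ with $\widehat\partial_p(c)=\curlywedge(\partial_p(c))$, and the cocritical complex is the cochain complex $(\widehat W[p],\widehat\delta_p)$ with $\widehat\delta_p(c)=\curlyvee(\delta_p(c))$ (these satisfy $\widehat\partial\circ\widehat\partial=0$ and $\widehat\delta\circ\widehat\delta=0$). $H_p(\widehat W)=\ker\widehat\partial_p/\operatorname{im}\widehat\partial_{p+1}$ and $H^p(\widehat W)=\ker\widehat\delta_p/\operatorname{im}\widehat\delta_{p-1}$. -}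

module Defs where

open import Algebra.Bundles using (CommutativeRing)
open import Algebra.Module.Bundles using (Module)
open import Algebra.Module.Morphism.Structures using (module ModuleMorphisms)
open import Algebra.Module.Structures.Biased using (IsModuleFromLeft)
open import Data.Bool.Base using (Bool; true; false; _∧_; _xor_; if_then_else_)
open import Data.Bool.Properties using (xor-∧-commutativeRing; xor-assoc; xor-comm; xor-same; xor-identityʳ; ∧-distribʳ-xor; ∧-assoc; ∧-zeroʳ) renaming (_≟_ to _≟ᵇ_)
open import Data.Empty using (⊥; ⊥-elim)
open import Data.Fin.Base using (Fin; zero; suc)
open import Data.Fin.Subset using (Subset; Nonempty; _⊆_; _⊂_; ∣_∣; ⁅_⁆; _∪_; inside; outside) renaming (_∈_ to _∈ˢ_; _∉_ to _∉ˢ_)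
open import Data.Fin.Subset.Properties using (_⊆?_; p⊆p∪q; x∈p∪q⁻; x∈p∪q⁺; x∈⁅x⁆; x∈⁅y⁆⇒x≡y; ∪-identityʳ)
open import Data.Integer.Base using (ℤ; +_; 1ℤ; -1ℤ; _+_; _-_)
open import Data.Integer.Properties using () renaming (_≟_ to _≟ᶻ_)
import Data.Integer.Properties as ℤₚ
open import Data.Nat.Base using (ℕ; zero; suc)
open import Data.Product.Base using (Σ; ∃; _×_; _,_; proj₁; proj₂)
open import Data.Sum.Base using (_⊎_; inj₁; inj₂)
open import Data.Vec.Base using ([]; _∷_; here; there)
open import Data.Vec.Properties using (≡-dec)
open import Function.Base using (_∘_; id)
open import Function.Bundles using (_⇔_; Equivalence)
open import Level using (0ℓ)
open import Relation.Binary.Definitions using (DecidableEquality)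
open import Relation.Binary.PropositionalEquality using (_≡_; _≢_; _≗_; refl; sym; trans; cong; cong₂; subst; module ≡-Reasoning)
open import Relation.Nullary using (¬_; Dec; does; yes; no)
open import Relation.Nullary.Decidable using (dec-true; dec-false)

private
  variable
    n : ℕ

-- Vertices are taken in Fin n, for arbitrary n.

_≟ˢ_ : DecidableEquality (Subset n)
_≟ˢ_ = ≡-dec _≟ᵇ_

Family : ℕ → Set
Family n = Subset n → Bool

infix 4 _∈ᶠ_ _∈_ _∉_

_∈ᶠ_ : Subset n → Family n → Set
σ ∈ᶠ F = F σ ≡ true

record SimplicialComplex (n : ℕ) : Set where
  field
    simplices : Family n
    nonempty  : ∀ {σ} → σ ∈ᶠ simplices → Nonempty σ
    closed    : ∀ {σ τ} → τ ∈ᶠ simplices → σ ⊆ τ → Nonempty σ → σ ∈ᶠ simplices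

open SimplicialComplex public

_∈_ _∉_ : Subset n → SimplicialComplex n → Set
σ ∈ K = σ ∈ᶠ simplices K
σ ∉ K = ¬ (σ ∈ K)

dim : Subset n → ℤ
dim σ = + ∣ σ ∣ - 1ℤ

record FreePair (K : SimplicialComplex n) (σ τ : Subset n) : Set where
  field
    σ∈K  : σ ∈ K
    τ∈K  : τ ∈ K
    σ⊂τ  : σ ⊂ τ
    only : ∀ ρ → ρ ∈ K → σ ⊆ ρ → ρ ≢ σ → ρ ≡ τ

record Facet (K : SimplicialComplex n) (ν : Subset n) : Set where
  field
    ν∈K     : ν ∈ K
    maximal : ∀ ρ → ρ ∈ K → ν ⊆ ρ → ρ ≡ ν

-- The last argument of each constructor says L = K ∖ {σ , τ}, respectively
-- L = K ∖ {ν}.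
data _↗_ {n} (L K : SimplicialComplex n) : Set where
  expansion : ∀ σ τ → FreePair K σ τ →
              (∀ ρ → ρ ∈ L ⇔ (ρ ∈ K × ρ ≢ σ × ρ ≢ τ)) → L ↗ K
  filling   : ∀ ν → Facet K ν →
              (∀ ρ → ρ ∈ L ⇔ (ρ ∈ K × ρ ≢ ν)) → L ↗ K

infixl 5 _▷_

-- Indexed by the last complex of the sequence.
data MorseSequence {n} : SimplicialComplex n → Set where
  start : ∀ {K} → (∀ σ → σ ∉ K) → MorseSequence K
  _▷_   : ∀ {L K} → MorseSequence L → L ↗ K → MorseSequence K

Critical LowerRegular UpperRegular :
  {K : SimplicialComplex n} → MorseSequence K → Subset n → Set
Critical (start _)               ρ = ⊥
Critical (W ▷ expansion _ _ _ _) ρ = Critical W ρ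
Critical (W ▷ filling ν _ _)     ρ = ρ ≡ ν ⊎ Critical W ρ

LowerRegular (start _)               ρ = ⊥
LowerRegular (W ▷ expansion σ _ _ _) ρ = ρ ≡ σ ⊎ LowerRegular W ρ
LowerRegular (W ▷ filling _ _ _)     ρ = LowerRegular W ρ

UpperRegular (start _)               ρ = ⊥
UpperRegular (W ▷ expansion _ τ _ _) ρ = ρ ≡ τ ⊎ UpperRegular W ρ
UpperRegular (W ▷ filling _ _ _)     ρ = UpperRegular W ρ

-- Every chain space below is a subspace of the ℤ₂-vector space of
-- all families of subsets of Fin n, with symmetric difference as sum and
-- pointwise equality.

ℤ₂ : CommutativeRing 0ℓ 0ℓ
ℤ₂ = xor-∧-commutativeRing

Chain : ℕ → Set
Chain = Family

0ᶜ : Chain n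
0ᶜ _ = false

infixl 6 _⊕_
_⊕_ : Chain n → Chain n → Chain n
(c ⊕ d) σ = c σ xor d σ

⟨_⟩ : Subset n → Chain n
⟨ σ ⟩ ρ = does (ρ ≟ˢ σ)

-- Sum in ℤ₂ over all subsets of Fin n.
⨁ : (Subset n → Bool) → Bool
⨁ {zero}  g = g []
⨁ {suc n} g = ⨁ (λ σ → g (outside ∷ σ)) xor ⨁ (λ σ → g (inside ∷ σ))

-- Linear extension of a map on simplices: the sum of f σ over σ ∈ c.
lin : (Subset n → Chain n) → Chain n → Chain n
lin f c x = ⨁ (λ σ → c σ ∧ f σ x)

⨁-cong : {g h : Subset n → Bool} → g ≗ h → ⨁ g ≡ ⨁ h
⨁-cong {zero}  e = e []
⨁-cong {suc n} e = cong₂ _xor_ (⨁-cong (λ σ → e (outside ∷ σ))) (⨁-cong (λ σ → e (inside ∷ σ)))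

⨁-false : {g : Subset n → Bool} → (∀ σ → g σ ≡ false) → ⨁ g ≡ false
⨁-false {zero}  e = e []
⨁-false {suc n} e = cong₂ _xor_ (⨁-false (λ σ → e (outside ∷ σ))) (⨁-false (λ σ → e (inside ∷ σ)))

xor-interchange : ∀ a b c d → (a xor b) xor (c xor d) ≡ (a xor c) xor (b xor d)
xor-interchange a b c d = begin
  (a xor b) xor (c xor d) ≡⟨ xor-assoc a b (c xor d) ⟩
  a xor (b xor (c xor d)) ≡⟨ cong (a xor_) (xor-assoc b c d) ⟨
  a xor ((b xor c) xor d) ≡⟨ cong (λ z → a xor (z xor d)) (xor-comm b c) ⟩
  a xor ((c xor b) xor d) ≡⟨ cong (a xor_) (xor-assoc c b d) ⟩
  a xor (c xor (b xor d)) ≡⟨ xor-assoc a c (b xor d) ⟨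
  (a xor c) xor (b xor d) ∎
  where open ≡-Reasoning

xor≡false⇒≡ : ∀ a b → a xor b ≡ false → a ≡ b
xor≡false⇒≡ false false _ = refl
xor≡false⇒≡ true  true  _ = refl

⨁-xor : (g h : Subset n → Bool) → ⨁ (λ σ → g σ xor h σ) ≡ ⨁ g xor ⨁ h
⨁-xor {zero}  g h = refl
⨁-xor {suc n} g h = trans
  (cong₂ _xor_ (⨁-xor (λ σ → g (outside ∷ σ)) (λ σ → h (outside ∷ σ)))
               (⨁-xor (λ σ → g (inside ∷ σ)) (λ σ → h (inside ∷ σ))))
  (xor-interchange (⨁ (λ σ → g (outside ∷ σ))) (⨁ (λ σ → h (outside ∷ σ))) (⨁ (λ σ → g (inside ∷ σ))) (⨁ (λ σ → h (inside ∷ σ))))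

⨁-witness : (g : Subset n → Bool) → ⨁ g ≡ true → ∃ λ σ → g σ ≡ true
⨁-witness {zero}  g e = [] , e
⨁-witness {suc n} g e with ⨁ (λ σ → g (outside ∷ σ)) in eq
... | true  = let σ , p = ⨁-witness (λ σ → g (outside ∷ σ)) eq in outside ∷ σ , p
... | false = let σ , p = ⨁-witness (λ σ → g (inside ∷ σ)) e in inside ∷ σ , p

⨁-single : (a : Subset n) (g : Subset n → Bool) → (∀ σ → σ ≢ a → g σ ≡ false) → ⨁ g ≡ g a
⨁-single []            g e = refl
⨁-single (outside ∷ a) g e = trans
  (cong₂ _xor_ (⨁-single a (λ σ → g (outside ∷ σ)) (λ σ ne → e (outside ∷ σ) λ { refl → ne refl }))
               (⨁-false (λ σ → e (inside ∷ σ) λ ())))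
  (xor-identityʳ _)
⨁-single (inside ∷ a)  g e =
  cong₂ _xor_ (⨁-false (λ σ → e (outside ∷ σ) λ ()))
              (⨁-single a (λ σ → g (inside ∷ σ)) (λ σ ne → e (inside ∷ σ) λ { refl → ne refl }))

lin-cong : (f : Subset n → Chain n) {c d : Chain n} → c ≗ d → lin f c ≗ lin f d
lin-cong f e x = ⨁-cong (λ σ → cong (_∧ f σ x) (e σ))

lin-⊕ : (f : Subset n → Chain n) (c d : Chain n) → lin f (c ⊕ d) ≗ lin f c ⊕ lin f d
lin-⊕ f c d x = trans (⨁-cong (λ σ → ∧-distribʳ-xor (f σ x) (c σ) (d σ)))
                      (⨁-xor (λ σ → c σ ∧ f σ x) (λ σ → d σ ∧ f σ x))

lin-agree : {f g : Subset n → Chain n} (c : Chain n) →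
            (∀ σ → σ ∈ᶠ c → f σ ≗ g σ) → lin f c ≗ lin g c
lin-agree {f = f} {g} c e x = ⨁-cong λ σ → helper σ (c σ) refl
  where
  helper : ∀ σ b → c σ ≡ b → b ∧ f σ x ≡ b ∧ g σ x
  helper σ true  q = e σ q x
  helper σ false q = refl

lin-witness : (f : Subset n → Chain n) (c : Chain n) {x : Subset n} → x ∈ᶠ lin f c →
              ∃ λ σ → σ ∈ᶠ c × x ∈ᶠ f σ
lin-witness f c {x} e = let σ , p = ⨁-witness _ e in σ , split (c σ) (f σ x) p
  where
  split : ∀ a b → a ∧ b ≡ true → a ≡ true × b ≡ true
  split true true _ = refl , refl

-- If f and g agree on c away from a ∈ c, then f a is determined by lin f c.
lin-solve : (f g : Subset n → Chain n) (c : Chain n) (a : Subset n) → a ∈ᶠ c →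
            lin f c ≗ lin g c → (∀ σ → σ ∈ᶠ c → σ ≢ a → f σ ≗ g σ) → f a ≗ g a
lin-solve f g c a a∈c eq agree x = xor≡false⇒≡ _ _ (begin
  f a x xor g a x                      ≡⟨ cong₂ (λ u v → (u ∧ f a x) xor (v ∧ g a x)) a∈c a∈c ⟨
  h a                                  ≡⟨ ⨁-single a h vanish ⟨
  ⨁ h                                  ≡⟨ ⨁-xor (λ σ → c σ ∧ f σ x) (λ σ → c σ ∧ g σ x) ⟩
  lin f c x xor lin g c x              ≡⟨ cong (_xor lin g c x) (eq x) ⟩
  lin g c x xor lin g c x              ≡⟨ xor-same (lin g c x) ⟩
  false                                ∎)
  where
  open ≡-Reasoning
  h = λ σ → (c σ ∧ f σ x) xor (c σ ∧ g σ x)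
  helper : ∀ σ → σ ≢ a → ∀ b → c σ ≡ b → (b ∧ f σ x) xor (b ∧ g σ x) ≡ false
  helper σ ne false _ = refl
  helper σ ne true  q = trans (cong (_xor g σ x) (agree σ q ne x)) (xor-same (g σ x))
  vanish : ∀ σ → σ ≢ a → h σ ≡ false
  vanish σ ne = helper σ ne (c σ) refl

record Subspace (n : ℕ) : Set₁ where
  field
    Mem  : Chain n → Set
    resp : ∀ {c d} → c ≗ d → Mem c → Mem d
    zero∈ : Mem 0ᶜ
    add∈  : ∀ {c d} → Mem c → Mem d → Mem (c ⊕ d)

open Subspace public

record LinearMap (n : ℕ) : Set where
  field
    app      : Chain n → Chain n
    app-cong : ∀ {c d} → c ≗ d → app c ≗ app d
    app-⊕    : ∀ c d → app (c ⊕ d) ≗ app c ⊕ app d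

  app-0 : app 0ᶜ ≗ 0ᶜ
  app-0 x = trans (app-⊕ 0ᶜ 0ᶜ x) (xor-same (app 0ᶜ x))

open LinearMap public

extend : (Subset n → Chain n) → LinearMap n
extend f = record { app = lin f ; app-cong = lin-cong f ; app-⊕ = lin-⊕ f }

infixr 9 _∘ₗ_
_∘ₗ_ : LinearMap n → LinearMap n → LinearMap n
f ∘ₗ g = record
  { app      = app f ∘ app g
  ; app-cong = λ e → app-cong f (app-cong g e)
  ; app-⊕    = λ c d x → trans (app-cong f (app-⊕ g c d) x) (app-⊕ f (app g c) (app g d) x)
  }

supported : (Subset n → Set) → Subspace n
supported P = record
  { Mem   = λ c → ∀ σ → σ ∈ᶠ c → P σ
  ; resp  = λ e m σ q → m σ (trans (e σ) q)
  ; zero∈ = λ σ ()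
  ; add∈  = λ {c} {d} m m′ σ q → helper (c σ) (d σ) q (m σ) (m′ σ)
  }
  where
  helper : ∀ {σ} a b → a xor b ≡ true → (a ≡ true → P σ) → (b ≡ true → P σ) → P σ
  helper true  b    _ f g = f refl
  helper false true _ f g = g refl

ker : LinearMap n → Subspace n → Subspace n
ker f C = record
  { Mem   = λ c → Mem C c × app f c ≗ 0ᶜ
  ; resp  = λ e (m , z) → resp C e m , λ x → trans (sym (app-cong f e x)) (z x)
  ; zero∈ = zero∈ C , app-0 f
  ; add∈  = λ {c} {d} (m , z) (m′ , z′) → add∈ C m m′ ,
              λ x → trans (app-⊕ f c d x) (cong₂ _xor_ (z x) (z′ x))
  }

im : LinearMap n → Subspace n → Subspace n
im f C = record
  { Mem   = λ c → ∃ λ d → Mem C d × app f d ≗ c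
  ; resp  = λ e (d , m , z) → d , m , λ x → trans (z x) (e x)
  ; zero∈ = 0ᶜ , zero∈ C , app-0 f
  ; add∈  = λ (d , m , z) (d′ , m′ , z′) → d ⊕ d′ , add∈ C m m′ ,
              λ x → trans (app-⊕ f d d′ x) (cong₂ _xor_ (z x) (z′ x))
  }

-- The quotient Z / B: elements of Z, two of them being equal when their
-- difference (which is their sum, mod 2) lies in B.  It is only used with
-- B = im and Z = ker for consecutive maps of a (co)chain complex, where B ⊆ Z.
infix 7 _/_
_/_ : Subspace n → Subspace n → Module ℤ₂ 0ℓ 0ℓ
_/_ {n} Z B = record
  { Carrierᴹ = Σ (Chain n) (Mem Z)
  ; _≈ᴹ_     = λ (c , _) (d , _) → Mem B (c ⊕ d)
  ; _+ᴹ_     = λ (c , m) (d , m′) → c ⊕ d , add∈ Z m m′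
  ; _*ₗ_     = scale
  ; _*ᵣ_     = λ z b → scale b z
  ; 0ᴹ       = 0ᶜ , zero∈ Z
  ; -ᴹ_      = id
  ; isModule = IsModuleFromLeft.isModule {commutativeRing = ℤ₂} record { isLeftModule = record
    { isLeftSemimodule = record
      { +ᴹ-isCommutativeMonoid = record
        { isMonoid = record
          { isSemigroup = record
            { isMagma = record
              { isEquivalence = record
                { refl  = λ {(c , _)} → self c
                ; sym   = λ {(c , _)} {(d , _)} → resp B (λ σ → xor-comm (c σ) (d σ))
                ; trans = λ {(c , _)} {(d , _)} {(e , _)} p q → resp B (λ σ → cancel (c σ) (d σ) (e σ)) (add∈ B p q)
                }
              ; ∙-cong = λ {(c , _)} {(d , _)} {(e , _)} {(f , _)} p q →
                  resp B (λ σ → xor-interchange (c σ) (d σ) (e σ) (f σ)) (add∈ B p q)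
              }
            ; assoc = λ (c , _) (d , _) (e , _) → ≗⇒≈ (λ σ → xor-assoc (c σ) (d σ) (e σ))
            }
          ; identity = (λ (c , _) → self c) , (λ (c , _) → ≗⇒≈ (λ σ → xor-identityʳ (c σ)))
          }
        ; comm = λ (c , _) (d , _) → ≗⇒≈ (λ σ → xor-comm (c σ) (d σ))
        }
      ; isPreleftSemimodule = record
        { *ₗ-cong      = λ { {false} refl p → zero∈ B ; {true} refl p → p }
        ; *ₗ-zeroˡ     = λ _ → zero∈ B
        ; *ₗ-distribʳ  = λ (c , _) a b → ≗⇒≈ (λ σ → ∧-distribʳ-xor (c σ) a b)
        ; *ₗ-identityˡ = λ (c , _) → self c
        ; *ₗ-assoc     = λ a b (c , _) → ≗⇒≈ (λ σ → ∧-assoc a b (c σ))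
        ; *ₗ-zeroʳ     = λ a → ≗⇒≈ (λ σ → ∧-zeroʳ a)
        ; *ₗ-distribˡ  = λ { false _ _ → zero∈ B ; true (c , _) (d , _) → self (c ⊕ d) }
        }
      }
    ; -ᴹ‿cong    = id
    ; -ᴹ‿inverse = (λ (c , _) → ≗⇒≈ (λ σ → xor-same (c σ))) , (λ (c , _) → ≗⇒≈ (λ σ → xor-same (c σ)))
    } }
  }
  where
  scale : Bool → Σ (Chain n) (Mem Z) → Σ (Chain n) (Mem Z)
  scale b (c , m) = (λ σ → b ∧ c σ) , scale∈ b m
    where
    scale∈ : ∀ b → Mem Z c → Mem Z (λ σ → b ∧ c σ)
    scale∈ false _ = zero∈ Z
    scale∈ true  m = m
  ≗⇒≈ : ∀ {c d} → c ≗ d → Mem B (c ⊕ d)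
  ≗⇒≈ {c} {d} e = resp B (λ σ → sym (trans (cong (_xor d σ) (e σ)) (xor-same (d σ)))) (zero∈ B)
  self : ∀ c → Mem B (c ⊕ c)
  self c = ≗⇒≈ {c} (λ _ → refl)
  cancel : ∀ a b c → (a xor b) xor (b xor c) ≡ a xor c
  cancel a b c = trans (xor-assoc a b (b xor c))
    (cong (a xor_) (trans (sym (xor-assoc b b c)) (cong (_xor c) (xor-same b))))

infix 4 _≅_
_≅_ : Module ℤ₂ 0ℓ 0ℓ → Module ℤ₂ 0ℓ 0ℓ → Set
M ≅ N = ∃ IsModuleIsomorphism
  where open ModuleMorphisms (Module.rawModule M) (Module.rawModule N)

-- The index p ranges over ℤ; since simplices
-- are non-empty, the chain spaces vanish for p < 0.

_[_] : SimplicialComplex n → ℤ → Subspace n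
K [ p ] = supported λ σ → σ ∈ K × dim σ ≡ p

∂ˢ δˢ : SimplicialComplex n → Subset n → Chain n
∂ˢ K σ τ = simplices K τ ∧ does (τ ⊆? σ) ∧ does (dim τ ≟ᶻ dim σ - 1ℤ)
δˢ K σ τ = simplices K τ ∧ does (σ ⊆? τ) ∧ does (dim τ ≟ᶻ dim σ + 1ℤ)

∂ δ : SimplicialComplex n → LinearMap n
∂ K = extend (∂ˢ K)
δ K = extend (δˢ K)

Homology Cohomology : SimplicialComplex n → ℤ → Module ℤ₂ 0ℓ 0ℓ
Homology   K p = ker (∂ K) (K [ p ]) / im (∂ K) (K [ p + 1ℤ ])
Cohomology K p = ker (δ K) (K [ p ]) / im (δ K) (K [ p - 1ℤ ])

-- W ⟦ p ⟧ is Ŵ[p].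
_⟦_⟧ : {K : SimplicialComplex n} → MorseSequence K → ℤ → Subspace n
_⟦_⟧ {K = K} W p = supported λ σ → (σ ∈ K × dim σ ≡ p) × Critical W σ

record IsReferenceMap {K : SimplicialComplex n} (W : MorseSequence K)
                      (f : Subset n → Chain n) : Set where
  field
    graded   : ∀ σ → σ ∈ K → Mem (W ⟦ dim σ ⟧) (f σ)
    critical : ∀ ν → Critical W ν → f ν ≗ ⟨ ν ⟩
    upper    : ∀ τ → UpperRegular W τ → f τ ≗ 0ᶜ
    upper∂   : ∀ τ → UpperRegular W τ → lin f (∂ˢ K τ) ≗ 0ᶜ

record IsCoreferenceMap {K : SimplicialComplex n} (W : MorseSequence K)
                        (f : Subset n → Chain n) : Set where
  field
    graded   : ∀ σ → σ ∈ K → Mem (W ⟦ dim σ ⟧) (f σ)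
    critical : ∀ ν → Critical W ν → f ν ≗ ⟨ ν ⟩
    lower    : ∀ σ → LowerRegular W σ → f σ ≗ 0ᶜ
    lowerδ   : ∀ σ → LowerRegular W σ → lin f (δˢ K σ) ≗ 0ᶜ

_[_↦_] : (Subset n → Chain n) → Subset n → Chain n → Subset n → Chain n
(f [ a ↦ c ]) ρ = if does (ρ ≟ˢ a) then c else f ρ

-- The two maps are computed along the sequence (forwards for the reference
-- map, backwards for the coreference map), K being the final complex.  A
-- simplex not yet visited has value 0ᶜ, so that for an expansion by (σ , τ)
-- the value given to σ is that of ∂ τ ∖ {σ}, and the value given to τ by the
-- coreference map is that of δ σ ∖ {τ}.  Below, reference and coreference are
-- shown to be the unique maps satisfying IsReferenceMap and IsCoreferenceMap.
referenceIn : (K : SimplicialComplex n) {L : SimplicialComplex n} →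
              MorseSequence L → Subset n → Chain n
referenceIn K (start _)               = λ _ → 0ᶜ
referenceIn K (W ▷ expansion σ τ _ _) = let f = referenceIn K W in f [ σ ↦ lin f (∂ˢ K τ) ]
referenceIn K (W ▷ filling ν _ _)     = referenceIn K W [ ν ↦ ⟨ ν ⟩ ]

coreferenceIn : (K : SimplicialComplex n) {L : SimplicialComplex n} →
                MorseSequence L → (Subset n → Chain n) → Subset n → Chain n
coreferenceIn K (start _)               f = f
coreferenceIn K (W ▷ expansion σ τ _ _) f = coreferenceIn K W (f [ τ ↦ lin f (δˢ K σ) ])
coreferenceIn K (W ▷ filling ν _ _)     f = coreferenceIn K W (f [ ν ↦ ⟨ ν ⟩ ])

reference coreference : {K : SimplicialComplex n} → MorseSequence K → Subset n → Chain n
reference   {K = K} W = referenceIn K W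
coreference {K = K} W = coreferenceIn K W (λ _ → 0ᶜ)

private
  ∧-split : ∀ a {b} → a ∧ b ≡ true → a ≡ true × b ≡ true
  ∧-split true e = refl , e

  does⇒ : ∀ {P : Set} (p? : Dec P) → does p? ≡ true → P
  does⇒ (yes p) _ = p

∈∂ˢ⁻ : ∀ (K : SimplicialComplex n) σ {τ} → τ ∈ᶠ ∂ˢ K σ → τ ∈ K × τ ⊆ σ × dim τ ≡ dim σ - 1ℤ
∈∂ˢ⁻ K σ {τ} e =
  let p , q = ∧-split (simplices K τ) e
      r , s = ∧-split (does (τ ⊆? σ)) q
  in p , (λ {x} → does⇒ (τ ⊆? σ) r {x}) , does⇒ (dim τ ≟ᶻ dim σ - 1ℤ) s

∈∂ˢ⁺ : ∀ (K : SimplicialComplex n) {σ τ} → τ ∈ K → τ ⊆ σ → dim τ ≡ dim σ - 1ℤ → τ ∈ᶠ ∂ˢ K σ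
∈∂ˢ⁺ K {σ} {τ} p q r = cong₂ _∧_ p (cong₂ _∧_ (dec-true (τ ⊆? σ) q) (dec-true (dim τ ≟ᶻ dim σ - 1ℤ) r))

∈δˢ⁻ : ∀ (K : SimplicialComplex n) σ {τ} → τ ∈ᶠ δˢ K σ → τ ∈ K × σ ⊆ τ × dim τ ≡ dim σ + 1ℤ
∈δˢ⁻ K σ {τ} e =
  let p , q = ∧-split (simplices K τ) e
      r , s = ∧-split (does (σ ⊆? τ)) q
  in p , (λ {x} → does⇒ (σ ⊆? τ) r {x}) , does⇒ (dim τ ≟ᶻ dim σ + 1ℤ) s

∈δˢ⁺ : ∀ (K : SimplicialComplex n) {σ τ} → τ ∈ K → σ ⊆ τ → dim τ ≡ dim σ + 1ℤ → τ ∈ᶠ δˢ K σ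
∈δˢ⁺ K {σ} {τ} p q r = cong₂ _∧_ p (cong₂ _∧_ (dec-true (σ ⊆? τ) q) (dec-true (dim τ ≟ᶻ dim σ + 1ℤ) r))

∣p∪⁅x⁆∣ : (p : Subset n) {x : Fin n} → x ∉ˢ p → ∣ p ∪ ⁅ x ⁆ ∣ ≡ suc ∣ p ∣
∣p∪⁅x⁆∣ (inside  ∷ p) {zero}  x∉ = ⊥-elim (x∉ here)
∣p∪⁅x⁆∣ (outside ∷ p) {zero}  x∉ = cong (suc ∘ ∣_∣) (∪-identityʳ p)
∣p∪⁅x⁆∣ (inside  ∷ p) {suc x} x∉ = cong suc (∣p∪⁅x⁆∣ p (x∉ ∘ there))
∣p∪⁅x⁆∣ (outside ∷ p) {suc x} x∉ = ∣p∪⁅x⁆∣ p (x∉ ∘ there)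

module _ {K : SimplicialComplex n} {σ τ : Subset n} (free : FreePair K σ τ) where
  open FreePair free

  freePair-card : ∣ τ ∣ ≡ suc ∣ σ ∣
  freePair-card = let σ⊆τ , x , x∈τ , x∉σ = σ⊂τ in go σ⊆τ x x∈τ x∉σ
    where
    go : σ ⊆ τ → ∀ x → x ∈ˢ τ → x ∉ˢ σ → ∣ τ ∣ ≡ suc ∣ σ ∣
    go σ⊆τ x x∈τ x∉σ = trans (cong ∣_∣ (sym ρ≡τ)) (∣p∪⁅x⁆∣ σ x∉σ)
      where
      ρ = σ ∪ ⁅ x ⁆
      x∈ρ : x ∈ˢ ρ
      x∈ρ = x∈p∪q⁺ (inj₂ (x∈⁅x⁆ x))
      ρ⊆τ : ρ ⊆ τ
      ρ⊆τ y∈ with x∈p∪q⁻ σ ⁅ x ⁆ y∈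
      ... | inj₁ y∈σ = σ⊆τ y∈σ
      ... | inj₂ y∈x = subst (_∈ˢ τ) (sym (x∈⁅y⁆⇒x≡y x y∈x)) x∈τ
      ρ≡τ : ρ ≡ τ
      ρ≡τ = only ρ (closed K τ∈K ρ⊆τ (x , x∈ρ)) (p⊆p∪q ⁅ x ⁆)
                 (λ ρ≡σ → x∉σ (subst (x ∈ˢ_) ρ≡σ x∈ρ))

  freePair-dim⁺ : dim τ ≡ dim σ + 1ℤ
  freePair-dim⁺ rewrite freePair-card = sym (trans (ℤₚ.+-assoc (+ ∣ σ ∣) -1ℤ 1ℤ) (ℤₚ.+-identityʳ (+ ∣ σ ∣)))

  freePair-dim⁻ : dim σ ≡ dim τ - 1ℤ
  freePair-dim⁻ rewrite freePair-card = refl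

  freePair-≢ : σ ≢ τ
  freePair-≢ refl = let _ , _ , x∈ , x∉ = σ⊂τ in x∉ x∈

infix 4 _⊑_
_⊑_ : SimplicialComplex n → SimplicialComplex n → Set
L ⊑ K = ∀ {ρ} → ρ ∈ L → ρ ∈ K

↗⇒⊑ : {L K : SimplicialComplex n} → L ↗ K → L ⊑ K
↗⇒⊑ (expansion _ _ _ d) {ρ} ρ∈L = proj₁ (Equivalence.to (d ρ) ρ∈L)
↗⇒⊑ (filling _ _ d)     {ρ} ρ∈L = proj₁ (Equivalence.to (d ρ) ρ∈L)

critical⇒∈ : {K : SimplicialComplex n} (W : MorseSequence K) {ρ : Subset n} → Critical W ρ → ρ ∈ K
critical⇒∈ (W ▷ s@(expansion _ _ _ _)) c           = ↗⇒⊑ s (critical⇒∈ W c)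
critical⇒∈ (W ▷ filling ν fa _)        (inj₁ refl) = Facet.ν∈K fa
critical⇒∈ (W ▷ s@(filling _ _ _))     (inj₂ c)    = ↗⇒⊑ s (critical⇒∈ W c)

upper⇒∈ : {K : SimplicialComplex n} (W : MorseSequence K) {ρ : Subset n} → UpperRegular W ρ → ρ ∈ K
upper⇒∈ (W ▷ expansion _ _ fp _)     (inj₁ refl) = FreePair.τ∈K fp
upper⇒∈ (W ▷ s@(expansion _ _ _ _)) (inj₂ c)    = ↗⇒⊑ s (upper⇒∈ W c)
upper⇒∈ (W ▷ s@(filling _ _ _))     c           = ↗⇒⊑ s (upper⇒∈ W c)

lower⇒∈ : {K : SimplicialComplex n} (W : MorseSequence K) {ρ : Subset n} → LowerRegular W ρ → ρ ∈ K
lower⇒∈ (W ▷ expansion _ _ fp _)     (inj₁ refl) = FreePair.σ∈K fp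
lower⇒∈ (W ▷ s@(expansion _ _ _ _)) (inj₂ c)    = ↗⇒⊑ s (lower⇒∈ W c)
lower⇒∈ (W ▷ s@(filling _ _ _))     c           = ↗⇒⊑ s (lower⇒∈ W c)

update-here : (f : Subset n → Chain n) (a : Subset n) (c : Chain n) → (f [ a ↦ c ]) a ≡ c
update-here f a c rewrite dec-true (a ≟ˢ a) refl = refl

update-there : (f : Subset n → Chain n) (a : Subset n) (c : Chain n) {ρ : Subset n} →
               ρ ≢ a → (f [ a ↦ c ]) ρ ≡ f ρ
update-there f a c {ρ} ne rewrite dec-false (ρ ≟ˢ a) ne = refl

update-all : (P : Subset n → Chain n → Set) (f : Subset n → Chain n) (a : Subset n) (c : Chain n) →
             (∀ ρ → P ρ (f ρ)) → P a c → ∀ ρ → P ρ ((f [ a ↦ c ]) ρ)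
update-all P f a c pf pc ρ with ρ ≟ˢ a
... | yes refl = pc
... | no  _    = pf ρ

-- Assigning lin f c to a simplex a ∈ c not yet visited makes c vanish.
lin-update : (f : Subset n → Chain n) (c : Chain n) (a : Subset n) → a ∈ᶠ c → f a ≗ 0ᶜ →
             lin (f [ a ↦ lin f c ]) c ≗ 0ᶜ
lin-update f c a a∈c fa≗0 x = begin
  lin f′ c x                             ≡⟨ xor-identityʳ (lin f′ c x) ⟨
  lin f′ c x xor false                   ≡⟨ cong (lin f′ c x xor_) (xor-same (lin f c x)) ⟨
  lin f′ c x xor (lin f c x xor lin f c x) ≡⟨ xor-assoc (lin f′ c x) (lin f c x) (lin f c x) ⟨
  (lin f′ c x xor lin f c x) xor lin f c x ≡⟨ cong (_xor lin f c x) diff ⟩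
  lin f c x xor lin f c x                ≡⟨ xor-same (lin f c x) ⟩
  false                                  ∎
  where
  open ≡-Reasoning
  f′ = f [ a ↦ lin f c ]
  h = λ σ → (c σ ∧ f′ σ x) xor (c σ ∧ f σ x)
  vanish : ∀ σ → σ ≢ a → h σ ≡ false
  vanish σ ne rewrite update-there f a (lin f c) ne = xor-same (c σ ∧ f σ x)
  at : h a ≡ lin f c x
  at rewrite update-here f a (lin f c) | a∈c | fa≗0 x = xor-identityʳ (lin f c x)
  diff : lin f′ c x xor lin f c x ≡ lin f c x
  diff = trans (sym (⨁-xor (λ σ → c σ ∧ f′ σ x) (λ σ → c σ ∧ f σ x)))
               (trans (⨁-single a h vanish) at)

≡⇒≗ : {c d : Chain n} → c ≡ d → c ≗ d
≡⇒≗ refl _ = refl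

⟨⟩-graded : (P : Subset n → Set) (ν : Subset n) → P ν → ∀ ρ → ρ ∈ᶠ ⟨ ν ⟩ → P ρ
⟨⟩-graded P ν pν ρ e = subst P (sym (does⇒ (ρ ≟ˢ ν) e)) pν

private
  record RefIn (K : SimplicialComplex n) {L : SimplicialComplex n} (W : MorseSequence L)
               (f : Subset n → Chain n) : Set where
    field
      outside₀ : ∀ ρ → ρ ∉ L → f ρ ≗ 0ᶜ
      graded   : ∀ ρ x → x ∈ᶠ f ρ → dim x ≡ dim ρ × Critical W x
      critical : ∀ ν → Critical W ν → f ν ≗ ⟨ ν ⟩
      upper    : ∀ τ → UpperRegular W τ → f τ ≗ 0ᶜ
      upper∂   : ∀ τ → UpperRegular W τ → lin f (∂ˢ K τ) ≗ 0ᶜ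

  ∂ˢ⊆ : (K : SimplicialComplex n) (L : SimplicialComplex n) {τ : Subset n} → τ ∈ L →
        ∀ ρ → ρ ∈ᶠ ∂ˢ K τ → ρ ∈ L
  ∂ˢ⊆ K L {τ} τ∈L ρ e = let ρ∈K , ρ⊆τ , _ = ∈∂ˢ⁻ K τ e in closed L τ∈L ρ⊆τ (nonempty K ρ∈K)

  refIn : (K : SimplicialComplex n) {L : SimplicialComplex n} → L ⊑ K → (W : MorseSequence L) →
          RefIn K W (referenceIn K W)
  refIn K L⊑K (start _) = record
    { outside₀ = λ _ _ _ → refl ; graded = λ _ _ () ; critical = λ _ ()
    ; upper = λ _ () ; upper∂ = λ _ () }
  refIn {n} K {L} L⊑K (_▷_ {L = L′} W s@(expansion σ τ fp d)) = record
    { outside₀ = λ ρ ρ∉ x → trans (≡⇒≗ (there′ λ { refl → ρ∉ σ∈K }) x) (IH.outside₀ ρ (ρ∉ ∘ ↗⇒⊑ s) x)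
    ; graded   = update-all (λ ρ c → ∀ x → x ∈ᶠ c → dim x ≡ dim ρ × Critical W x) f σ _ IH.graded
        (λ x e → let ρ , ρ∈ , x∈ = lin-witness f (∂ˢ K τ) e
                     dx , cx = IH.graded ρ x x∈
                     _ , _ , dρ = ∈∂ˢ⁻ K τ ρ∈
                 in trans dx (trans dρ (sym (freePair-dim⁻ fp))) , cx)
    ; critical = λ ν c x → trans (≡⇒≗ (there′ (old (critical⇒∈ W c))) x) (IH.critical ν c x)
    ; upper    = λ { _ (inj₁ refl) x → trans (≡⇒≗ (there′ (freePair-≢ fp ∘ sym)) x)
                       (IH.outside₀ τ (λ τ∈ → proj₂ (proj₂ (Equivalence.to (d τ) τ∈)) refl) x)
                   ; ρ (inj₂ u) x → trans (≡⇒≗ (there′ (old (upper⇒∈ W u))) x) (IH.upper ρ u x) }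
    ; upper∂   = λ { _ (inj₁ refl) → lin-update f (∂ˢ K τ) σ σ∈∂τ
                       (IH.outside₀ σ (λ σ∈ → proj₁ (proj₂ (Equivalence.to (d σ) σ∈)) refl))
                   ; ρ (inj₂ u) x → trans
                       (lin-agree (∂ˢ K ρ) (λ π π∈ → ≡⇒≗ (there′ (old (∂ˢ⊆ K L′ (upper⇒∈ W u) π π∈)))) x)
                       (IH.upper∂ ρ u x) }
    }
    where
    open FreePair fp
    f = referenceIn K W
    module IH = RefIn (refIn K (λ ρ∈ → L⊑K (↗⇒⊑ s ρ∈)) W)
    there′ : ∀ {ρ} → ρ ≢ σ → (f [ σ ↦ lin f (∂ˢ K τ) ]) ρ ≡ f ρ
    there′ = update-there f σ _
    old : ∀ {ρ} → ρ ∈ L′ → ρ ≢ σ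
    old {ρ} ρ∈ = proj₁ (proj₂ (Equivalence.to (d ρ) ρ∈))
    σ∈∂τ : σ ∈ᶠ ∂ˢ K τ
    σ∈∂τ = ∈∂ˢ⁺ K (L⊑K σ∈K) (proj₁ σ⊂τ) (freePair-dim⁻ fp)
  refIn {n} K {L} L⊑K (_▷_ {L = L′} W s@(filling ν fa d)) = record
    { outside₀ = λ ρ ρ∉ x → trans (≡⇒≗ (there′ λ { refl → ρ∉ ν∈K }) x) (IH.outside₀ ρ (ρ∉ ∘ ↗⇒⊑ s) x)
    ; graded   = update-all (λ ρ c → ∀ x → x ∈ᶠ c → dim x ≡ dim ρ × (x ≡ ν ⊎ Critical W x)) f ν _
        (λ ρ x e → let dx , cx = IH.graded ρ x e in dx , inj₂ cx)
        (⟨⟩-graded (λ x → dim x ≡ dim ν × (x ≡ ν ⊎ Critical W x)) ν (refl , inj₁ refl))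
    ; critical = λ { _ (inj₁ refl) → ≡⇒≗ (update-here f ν _)
                   ; ρ (inj₂ c) x → trans (≡⇒≗ (there′ (old (critical⇒∈ W c))) x) (IH.critical ρ c x) }
    ; upper    = λ ρ u x → trans (≡⇒≗ (there′ (old (upper⇒∈ W u))) x) (IH.upper ρ u x)
    ; upper∂   = λ ρ u x → trans
        (lin-agree (∂ˢ K ρ) (λ π π∈ → ≡⇒≗ (there′ (old (∂ˢ⊆ K L′ (upper⇒∈ W u) π π∈)))) x)
        (IH.upper∂ ρ u x)
    }
    where
    open Facet fa
    f = referenceIn K W
    module IH = RefIn (refIn K (λ ρ∈ → L⊑K (↗⇒⊑ s ρ∈)) W)
    there′ : ∀ {ρ} → ρ ≢ ν → (f [ ν ↦ ⟨ ν ⟩ ]) ρ ≡ f ρ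
    there′ = update-there f ν _
    old : ∀ {ρ} → ρ ∈ L′ → ρ ≢ ν
    old {ρ} ρ∈ = proj₂ (Equivalence.to (d ρ) ρ∈)

reference-isReferenceMap : {K : SimplicialComplex n} (W : MorseSequence K) →
                           IsReferenceMap W (reference W)
reference-isReferenceMap {K = K} W = record
  { graded   = λ σ _ x e → let dx , cx = R.graded σ x e in (critical⇒∈ W cx , dx) , cx
  ; critical = R.critical
  ; upper    = R.upper
  ; upper∂   = R.upper∂
  }
  where module R = RefIn (refIn K id W)

private
  refUnique : (K : SimplicialComplex n) {L : SimplicialComplex n} → L ⊑ K → (W : MorseSequence L)
              (f g : Subset n → Chain n) →
              (∀ ν → Critical W ν → f ν ≗ g ν) →
              (∀ τ → UpperRegular W τ → f τ ≗ g τ) →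
              (∀ τ → UpperRegular W τ → lin f (∂ˢ K τ) ≗ lin g (∂ˢ K τ)) →
              ∀ ρ → ρ ∈ L → f ρ ≗ g ρ
  refUnique K L⊑K (start e) f g c u u∂ ρ ρ∈ = ⊥-elim (e ρ ρ∈)
  refUnique {n} K {L} L⊑K (_▷_ {L = L′} W s@(expansion σ τ fp d)) f g c u u∂ = step
    where
    open FreePair fp
    IH : ∀ ρ → ρ ∈ L′ → f ρ ≗ g ρ
    IH = refUnique K (λ ρ∈ → L⊑K (↗⇒⊑ s ρ∈)) W f g c (λ τ → u τ ∘ inj₂) (λ τ → u∂ τ ∘ inj₂)
    notσ : ∀ ρ → ρ ∈ L → ρ ≢ σ → f ρ ≗ g ρ
    notσ ρ ρ∈ ρ≢σ with ρ ≟ˢ τ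
    ... | yes refl = u τ (inj₁ refl)
    ... | no ρ≢τ   = IH ρ (Equivalence.from (d ρ) (ρ∈ , ρ≢σ , ρ≢τ))
    step : ∀ ρ → ρ ∈ L → f ρ ≗ g ρ
    step ρ ρ∈ with ρ ≟ˢ σ
    ... | yes refl = lin-solve f g (∂ˢ K τ) σ (∈∂ˢ⁺ K (L⊑K σ∈K) (proj₁ σ⊂τ) (freePair-dim⁻ fp))
                       (u∂ τ (inj₁ refl)) (λ π π∈ → notσ π (∂ˢ⊆ K L τ∈K π π∈))
    ... | no ρ≢σ   = notσ ρ ρ∈ ρ≢σ
  refUnique K {L} L⊑K (_▷_ {L = L′} W s@(filling ν fa d)) f g c u u∂ ρ ρ∈ with ρ ≟ˢ ν
  ... | yes refl = c ν (inj₁ refl)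
  ... | no ρ≢ν   = refUnique K (λ π∈ → L⊑K (↗⇒⊑ s π∈)) W f g (λ π → c π ∘ inj₂) u u∂ ρ
                     (Equivalence.from (d ρ) (ρ∈ , ρ≢ν))

reference-unique : {K : SimplicialComplex n} (W : MorseSequence K) {f g : Subset n → Chain n} →
                   IsReferenceMap W f → IsReferenceMap W g → ∀ σ → σ ∈ K → f σ ≗ g σ
reference-unique {K = K} W {f} {g} F G = refUnique K id W f g
  (λ ν c x → trans (F.critical ν c x) (sym (G.critical ν c x)))
  (λ τ u x → trans (F.upper τ u x) (sym (G.upper τ u x)))
  (λ τ u x → trans (F.upper∂ τ u x) (sym (G.upper∂ τ u x)))
  where
  module F = IsReferenceMap F
  module G = IsReferenceMap G

private
  record CorefIn (K : SimplicialComplex n) {L : SimplicialComplex n} (W : MorseSequence L)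
                 (acc f : Subset n → Chain n) : Set where
    field
      later    : ∀ ρ → ρ ∉ L → f ρ ≗ acc ρ
      critical : ∀ ν → Critical W ν → f ν ≗ ⟨ ν ⟩
      lower    : ∀ σ → LowerRegular W σ → f σ ≗ 0ᶜ
      lowerδ   : ∀ σ → LowerRegular W σ → lin f (δˢ K σ) ≗ 0ᶜ

  corefIn : (K : SimplicialComplex n) {L : SimplicialComplex n} → L ⊑ K → (W : MorseSequence L) →
            (acc : Subset n → Chain n) → (∀ ρ → ρ ∈ L → acc ρ ≗ 0ᶜ) →
            CorefIn K W acc (coreferenceIn K W acc)
  corefIn K L⊑K (start _) acc z = record
    { later = λ _ _ _ → refl ; critical = λ _ () ; lower = λ _ () ; lowerδ = λ _ () }
  corefIn {n} K {L} L⊑K (_▷_ {L = L′} W s@(expansion σ τ fp d)) acc z = record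
    { later    = λ ρ ρ∉ x → trans (IH.later ρ (ρ∉ ∘ ↗⇒⊑ s) x) (≡⇒≗ (there′ λ { refl → ρ∉ τ∈K }) x)
    ; critical = IH.critical
    ; lower    = λ { _ (inj₁ refl) x → trans (IH.later σ σ∉ x) (trans (≡⇒≗ (there′ (freePair-≢ fp)) x) (z σ σ∈K x))
                   ; ρ (inj₂ l) → IH.lower ρ l }
    ; lowerδ   = λ { _ (inj₁ refl) x → trans
                       (lin-agree (δˢ K σ) (λ ρ ρ∈ → IH.later ρ (δ∉ ρ ρ∈)) x)
                       (lin-update acc (δˢ K σ) τ (∈δˢ⁺ K (L⊑K τ∈K) (proj₁ σ⊂τ) (freePair-dim⁺ fp)) (z τ τ∈K) x)
                   ; ρ (inj₂ l) → IH.lowerδ ρ l }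
    }
    where
    open FreePair fp
    acc′ = acc [ τ ↦ lin acc (δˢ K σ) ]
    there′ : ∀ {ρ} → ρ ≢ τ → acc′ ρ ≡ acc ρ
    there′ = update-there acc τ _
    old : ∀ {ρ} → ρ ∈ L′ → ρ ≢ τ
    old {ρ} ρ∈ = proj₂ (proj₂ (Equivalence.to (d ρ) ρ∈))
    σ∉ : σ ∉ L′
    σ∉ σ∈ = proj₁ (proj₂ (Equivalence.to (d σ) σ∈)) refl
    δ∉ : ∀ ρ → ρ ∈ᶠ δˢ K σ → ρ ∉ L′
    δ∉ ρ ρ∈δ ρ∈ = let _ , σ⊆ρ , _ = ∈δˢ⁻ K σ ρ∈δ in σ∉ (closed L′ ρ∈ σ⊆ρ (nonempty L σ∈K))
    module IH = CorefIn (corefIn K (λ ρ∈ → L⊑K (↗⇒⊑ s ρ∈)) W acc′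
      (λ ρ ρ∈ x → trans (≡⇒≗ (there′ (old ρ∈)) x) (z ρ (↗⇒⊑ s ρ∈) x)))
  corefIn {n} K {L} L⊑K (_▷_ {L = L′} W s@(filling ν fa d)) acc z = record
    { later    = λ ρ ρ∉ x → trans (IH.later ρ (ρ∉ ∘ ↗⇒⊑ s) x) (≡⇒≗ (there′ λ { refl → ρ∉ ν∈K }) x)
    ; critical = λ { _ (inj₁ refl) x → trans (IH.later ν ν∉ x) (≡⇒≗ (update-here acc ν ⟨ ν ⟩) x)
                   ; ρ (inj₂ c) → IH.critical ρ c }
    ; lower    = IH.lower
    ; lowerδ   = IH.lowerδ
    }
    where
    open Facet fa
    acc′ = acc [ ν ↦ ⟨ ν ⟩ ]
    there′ : ∀ {ρ} → ρ ≢ ν → acc′ ρ ≡ acc ρ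
    there′ = update-there acc ν _
    old : ∀ {ρ} → ρ ∈ L′ → ρ ≢ ν
    old {ρ} ρ∈ = proj₂ (Equivalence.to (d ρ) ρ∈)
    ν∉ : ν ∉ L′
    ν∉ ν∈ = old ν∈ refl
    module IH = CorefIn (corefIn K (λ ρ∈ → L⊑K (↗⇒⊑ s ρ∈)) W acc′
      (λ ρ ρ∈ x → trans (≡⇒≗ (there′ (old ρ∈)) x) (z ρ (↗⇒⊑ s ρ∈) x)))

  corefGraded : (K : SimplicialComplex n) {L : SimplicialComplex n} (W : MorseSequence L)
                (C : Subset n → Set) → (∀ ν → Critical W ν → C ν) → (acc : Subset n → Chain n) →
                (∀ ρ x → x ∈ᶠ acc ρ → dim x ≡ dim ρ × C x) →
                ∀ ρ x → x ∈ᶠ coreferenceIn K W acc ρ → dim x ≡ dim ρ × C x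
  corefGraded K (start _) C inC acc g = g
  corefGraded K (W ▷ expansion σ τ fp d) C inC acc g = corefGraded K W C inC _
    (update-all (λ ρ c → ∀ x → x ∈ᶠ c → dim x ≡ dim ρ × C x) acc τ _ g
      (λ x e → let ρ , ρ∈ , x∈ = lin-witness acc (δˢ K σ) e
                   dx , cx = g ρ x x∈
                   _ , _ , dρ = ∈δˢ⁻ K σ ρ∈
               in trans dx (trans dρ (sym (freePair-dim⁺ fp))) , cx))
  corefGraded K (W ▷ filling ν fa d) C inC acc g = corefGraded K W C (λ ρ → inC ρ ∘ inj₂) _
    (update-all (λ ρ c → ∀ x → x ∈ᶠ c → dim x ≡ dim ρ × C x) acc ν _ g
      (⟨⟩-graded (λ x → dim x ≡ dim ν × C x) ν (refl , inC ν (inj₁ refl))))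

coreference-isCoreferenceMap : {K : SimplicialComplex n} (W : MorseSequence K) →
                               IsCoreferenceMap W (coreference W)
coreference-isCoreferenceMap {K = K} W = record
  { graded   = λ σ _ x e →
      let dx , cx = corefGraded K W (Critical W) (λ _ → id) (λ _ → 0ᶜ) (λ _ _ ()) σ x e
      in (critical⇒∈ W cx , dx) , cx
  ; critical = R.critical
  ; lower    = R.lower
  ; lowerδ   = R.lowerδ
  }
  where module R = CorefIn (corefIn K id W (λ _ → 0ᶜ) (λ _ _ _ → refl))

private
  corefUnique : (K : SimplicialComplex n) {L : SimplicialComplex n} → L ⊑ K → (W : MorseSequence L)
                (f g : Subset n → Chain n) →
                (∀ ρ → ρ ∈ K → ρ ∉ L → f ρ ≗ g ρ) →
                (∀ ν → Critical W ν → f ν ≗ g ν) →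
                (∀ σ → LowerRegular W σ → f σ ≗ g σ) →
                (∀ σ → LowerRegular W σ → lin f (δˢ K σ) ≗ lin g (δˢ K σ)) →
                ∀ ρ → ρ ∈ K → f ρ ≗ g ρ
  corefUnique K L⊑K (start e) f g out c l lδ ρ ρ∈ = out ρ ρ∈ (e ρ)
  corefUnique {n} K {L} L⊑K (_▷_ {L = L′} W s@(expansion σ τ fp d)) f g out c l lδ =
    corefUnique K (λ ρ∈ → L⊑K (↗⇒⊑ s ρ∈)) W f g out′ c (λ σ → l σ ∘ inj₂) (λ σ → lδ σ ∘ inj₂)
    where
    open FreePair fp
    σ∉ : σ ∉ L′
    σ∉ σ∈ = proj₁ (proj₂ (Equivalence.to (d σ) σ∈)) refl
    notτ : ∀ ρ → ρ ∈ K → ρ ∉ L′ → ρ ≢ τ → f ρ ≗ g ρ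
    notτ ρ ρ∈ ρ∉ ρ≢τ with ρ ≟ˢ σ
    ... | yes refl = l σ (inj₁ refl)
    ... | no ρ≢σ   = out ρ ρ∈ (λ ρ∈L → ρ∉ (Equivalence.from (d ρ) (ρ∈L , ρ≢σ , ρ≢τ)))
    out′ : ∀ ρ → ρ ∈ K → ρ ∉ L′ → f ρ ≗ g ρ
    out′ ρ ρ∈ ρ∉ with ρ ≟ˢ τ
    ... | yes refl = lin-solve f g (δˢ K σ) τ (∈δˢ⁺ K (L⊑K τ∈K) (proj₁ σ⊂τ) (freePair-dim⁺ fp))
                       (lδ σ (inj₁ refl))
                       (λ π π∈ → let π∈K , σ⊆π , _ = ∈δˢ⁻ K σ π∈ in
                          notτ π π∈K (λ π∈L′ → σ∉ (closed L′ π∈L′ σ⊆π (nonempty L σ∈K))))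
    ... | no ρ≢τ   = notτ ρ ρ∈ ρ∉ ρ≢τ
  corefUnique {n} K {L} L⊑K (_▷_ {L = L′} W s@(filling ν fa d)) f g out c l lδ =
    corefUnique K (λ ρ∈ → L⊑K (↗⇒⊑ s ρ∈)) W f g out′ (λ ν → c ν ∘ inj₂) l lδ
    where
    out′ : ∀ ρ → ρ ∈ K → ρ ∉ L′ → f ρ ≗ g ρ
    out′ ρ ρ∈ ρ∉ with ρ ≟ˢ ν
    ... | yes refl = c ν (inj₁ refl)
    ... | no ρ≢ν   = out ρ ρ∈ (λ ρ∈L → ρ∉ (Equivalence.from (d ρ) (ρ∈L , ρ≢ν)))

coreference-unique : {K : SimplicialComplex n} (W : MorseSequence K) {f g : Subset n → Chain n} →
                     IsCoreferenceMap W f → IsCoreferenceMap W g → ∀ σ → σ ∈ K → f σ ≗ g σ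
coreference-unique {K = K} W {f} {g} F G = corefUnique K id W f g
  (λ ρ ρ∈ ρ∉ → ⊥-elim (ρ∉ ρ∈))
  (λ ν c x → trans (F.critical ν c x) (sym (G.critical ν c x)))
  (λ τ u x → trans (F.lower τ u x) (sym (G.lower τ u x)))
  (λ τ u x → trans (F.lowerδ τ u x) (sym (G.lowerδ τ u x)))
  where
  module F = IsCoreferenceMap F
  module G = IsCoreferenceMap G

∂̂ δ̂ : {K : SimplicialComplex n} → MorseSequence K → LinearMap n
∂̂ {K = K} W = extend (reference W) ∘ₗ ∂ K
δ̂ {K = K} W = extend (coreference W) ∘ₗ δ K

CriticalHomology CocriticalCohomology :
  {K : SimplicialComplex n} → MorseSequence K → ℤ → Module ℤ₂ 0ℓ 0ℓ
CriticalHomology     W p = ker (∂̂ W) (W ⟦ p ⟧) / im (∂̂ W) (W ⟦ p + 1ℤ ⟧)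
CocriticalCohomology W p = ker (δ̂ W) (W ⟦ p ⟧) / im (δ̂ W) (W ⟦ p - 1ℤ ⟧)

{-# OPTIONS --safe #-}
module Submission where

-- A Morse sequence lists K as critical simplices and matched pairs
-- (source, target), where the boundary of a target contains its source and
-- otherwise only simplices listed earlier.  Read forwards (source lower,
-- target upper) this holds for ∂; read backwards with the roles exchanged it
-- holds for δ, so one argument serves both parts.  The (co)reference map r
-- satisfies r d = r d r, hence is a chain map to the critical complex, which
-- it fixes.  Its kernel is acyclic: adding boundaries of targets to a cycle
-- killed by r removes all sources, then r shows that no critical simplex is
-- left, and a cycle made of targets only is zero because the source of its
-- last target cannot cancel.  So r is an isomorphism on homology.

open import Defs
open import Algebra.Module.Bundles using (Module)
open import Data.Bool.Base using (Bool; true; false; _∧_; _xor_)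
open import Data.Bool.Properties using (xor-assoc; xor-same; xor-identityʳ; ∧-distribʳ-xor; ∧-assoc; ∧-comm; ∧-zeroʳ; ∧-identityʳ; ∧-conicalˡ; ∧-conicalʳ; ⇔→≡)
open import Data.Empty using (⊥; ⊥-elim)
open import Data.Fin.Subset using (Subset; _⊆_; ∣_∣; inside; outside)
open import Data.Fin.Subset.Properties using (drop-∷-⊆; out⊆; s⊆s; ⊆-refl; p⊆q⇒∣p∣≤∣q∣)
open import Data.Integer.Base using (ℤ; +_; 1ℤ; -1ℤ; _+_; _-_)
import Data.Integer.Properties as ℤ
open import Data.List.Base using (List; []; _∷_)
open import Data.Nat.Base using (ℕ; zero; suc; s≤s)
import Data.Nat.Properties as ℕ
open import Data.Product.Base using (∃; _×_; _,_; proj₁; proj₂)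
open import Data.Sum.Base using (_⊎_; inj₁; inj₂; map₂)
open import Data.Vec.Base using ([]; _∷_; here)
open import Function.Base using (_∘_; id)
open import Function.Bundles using (Equivalence; mk⇔)
open import Relation.Binary.PropositionalEquality using (_≡_; _≢_; _≗_; refl; sym; trans; cong; cong₂; subst; module ≡-Reasoning)
open import Relation.Nullary using (¬_; yes; no; contradiction)
open import Relation.Nullary.Decidable using (dec-true; dec-false)

private
  variable
    m n : ℕ

-- Linear algebra of chains

⨁-swap : (g : Subset m → Subset n → Bool) →
         ⨁ (λ σ → ⨁ (g σ)) ≡ ⨁ (λ τ → ⨁ (λ σ → g σ τ))
⨁-swap {zero}  g = refl
⨁-swap {suc m} g = trans
  (cong₂ _xor_ (⨁-swap (λ σ → g (outside ∷ σ))) (⨁-swap (λ σ → g (inside ∷ σ))))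
  (sym (⨁-xor (λ τ → ⨁ (λ σ → g (outside ∷ σ) τ)) (λ τ → ⨁ (λ σ → g (inside ∷ σ) τ))))

⨁-∧ʳ : (g : Subset n → Bool) (b : Bool) → ⨁ g ∧ b ≡ ⨁ (λ σ → g σ ∧ b)
⨁-∧ʳ {zero}  g b = refl
⨁-∧ʳ {suc n} g b = trans
  (∧-distribʳ-xor b (⨁ (λ σ → g (outside ∷ σ))) (⨁ (λ σ → g (inside ∷ σ))))
  (cong₂ _xor_ (⨁-∧ʳ (λ σ → g (outside ∷ σ)) b) (⨁-∧ʳ (λ σ → g (inside ∷ σ)) b))

⨁-∧ˡ : (b : Bool) (g : Subset n → Bool) → ⨁ (λ σ → b ∧ g σ) ≡ b ∧ ⨁ g
⨁-∧ˡ true  g = refl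
⨁-∧ˡ false g = ⨁-false {g = λ σ → false ∧ g σ} (λ _ → refl)

⨁-closed : (S : Subspace n) (F : Subset m → Chain n) → (∀ σ → Mem S (F σ)) →
           Mem S (λ x → ⨁ (λ σ → F σ x))
⨁-closed {m = zero}  S F h = h []
⨁-closed {m = suc m} S F h =
  add∈ S (⨁-closed S (λ σ → F (outside ∷ σ)) (λ σ → h (outside ∷ σ)))
         (⨁-closed S (λ σ → F (inside ∷ σ)) (λ σ → h (inside ∷ σ)))

-- With a `supported` space as `S` this yields gradings; with `Reducible` it brings a claim about
-- chains down to single simplices.
lin-closed : (S : Subspace n) (f : Subset n → Chain n) (c : Chain n) →
             (∀ σ → σ ∈ᶠ c → Mem S (f σ)) → Mem S (lin f c)
lin-closed S f c h = ⨁-closed S (λ σ x → c σ ∧ f σ x) (λ σ → summand σ (c σ) refl)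
  where
  summand : ∀ σ b → c σ ≡ b → Mem S (λ x → b ∧ f σ x)
  summand σ true  e = h σ e
  summand σ false e = zero∈ S

-- The two summations are exchanged. Identities between composites of linear maps can then be
-- checked simplex by simplex.
lin-lin : (f g : Subset n → Chain n) (c : Chain n) →
          lin f (lin g c) ≗ lin (λ σ → lin f (g σ)) c
lin-lin f g c x = begin
  ⨁ (λ ρ → ⨁ (λ σ → c σ ∧ g σ ρ) ∧ f ρ x)   ≡⟨ ⨁-cong (λ ρ → ⨁-∧ʳ (λ σ → c σ ∧ g σ ρ) (f ρ x)) ⟩
  ⨁ (λ ρ → ⨁ (λ σ → (c σ ∧ g σ ρ) ∧ f ρ x)) ≡⟨ ⨁-swap (λ ρ σ → (c σ ∧ g σ ρ) ∧ f ρ x) ⟩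
  ⨁ (λ σ → ⨁ (λ ρ → (c σ ∧ g σ ρ) ∧ f ρ x)) ≡⟨ ⨁-cong (λ σ → ⨁-cong (λ ρ → ∧-assoc (c σ) (g σ ρ) (f ρ x))) ⟩
  ⨁ (λ σ → ⨁ (λ ρ → c σ ∧ (g σ ρ ∧ f ρ x))) ≡⟨ ⨁-cong (λ σ → ⨁-∧ˡ (c σ) (λ ρ → g σ ρ ∧ f ρ x)) ⟩
  ⨁ (λ σ → c σ ∧ ⨁ (λ ρ → g σ ρ ∧ f ρ x))   ∎
  where open ≡-Reasoning

lin-0 : (f : Subset n → Chain n) {c : Chain n} → c ≗ 0ᶜ → lin f c ≗ 0ᶜ
lin-0 f e x = trans (lin-cong f e x) (app-0 (extend f) x)

lin-vanish : {f : Subset n → Chain n} (c : Chain n) →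
             (∀ σ → σ ∈ᶠ c → f σ ≗ 0ᶜ) → lin f c ≗ 0ᶜ
lin-vanish c h x = trans (lin-agree c h x) (⨁-false (λ σ → ∧-zeroʳ (c σ)))

⟨⟩-self : (σ : Subset n) → ⟨ σ ⟩ σ ≡ true
⟨⟩-self σ = dec-true (σ ≟ˢ σ) refl

⟨⟩-≢ : {ρ σ : Subset n} → ρ ≢ σ → ⟨ σ ⟩ ρ ≡ false
⟨⟩-≢ {ρ = ρ} {σ} = dec-false (ρ ≟ˢ σ)

⟨⟩-sym : (ρ σ : Subset n) → ⟨ σ ⟩ ρ ≡ ⟨ ρ ⟩ σ
⟨⟩-sym ρ σ with ρ ≟ˢ σ
... | yes refl = sym (⟨⟩-self ρ)
... | no ρ≢σ   = sym (⟨⟩-≢ (ρ≢σ ∘ sym))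

⨁-⟨⟩ : (σ : Subset n) (g : Subset n → Bool) → ⨁ (λ ρ → ⟨ σ ⟩ ρ ∧ g ρ) ≡ g σ
⨁-⟨⟩ σ g = trans
  (⨁-single σ (λ ρ → ⟨ σ ⟩ ρ ∧ g ρ) (λ ρ ne → cong (_∧ g ρ) (⟨⟩-≢ ne)))
  (cong (_∧ g σ) (⟨⟩-self σ))

lin-⟨⟩ : (f : Subset n → Chain n) (σ : Subset n) → lin f ⟨ σ ⟩ ≗ f σ
lin-⟨⟩ f σ x = ⨁-⟨⟩ σ (λ ρ → f ρ x)

⟨⟩-lin : (c : Chain n) → lin ⟨_⟩ c ≗ c
⟨⟩-lin c x = trans
  (⨁-cong (λ ρ → trans (∧-comm (c ρ) (⟨ ρ ⟩ x)) (cong (_∧ c ρ) (⟨⟩-sym x ρ))))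
  (⨁-⟨⟩ x c)

⊕-zeros : {c d : Chain n} → c ≗ 0ᶜ → d ≗ 0ᶜ → c ⊕ d ≗ 0ᶜ
⊕-zeros p q x = cong₂ _xor_ (p x) (q x)

⊕-self : {c d : Chain n} → c ≗ d → c ⊕ d ≗ 0ᶜ
⊕-self {d = d} e x = trans (cong (_xor d x) (e x)) (xor-same (d x))

-- The relation y = x ∪ {v} with v ∉ x, and ∂ ∘ ∂ = 0 = δ ∘ δ

-- Defined by recursion on the bit vectors, in step with `⨁`, so that sums over intermediate sets
-- can be computed by induction. When the first vertex is the added one, the tails must coincide.
covers : Subset n → Subset n → Bool
covers []            []            = false
covers (outside ∷ x) (outside ∷ y) = covers x y
covers (outside ∷ x) (inside  ∷ y) = ⟨ y ⟩ x
covers (inside  ∷ x) (outside ∷ y) = false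
covers (inside  ∷ x) (inside  ∷ y) = covers x y

⊆∧card⇒≡ : (x y : Subset n) → x ⊆ y → ∣ y ∣ ≡ ∣ x ∣ → x ≡ y
⊆∧card⇒≡ []            []            _ _ = refl
⊆∧card⇒≡ (outside ∷ x) (outside ∷ y) s e = cong (outside ∷_) (⊆∧card⇒≡ x y (drop-∷-⊆ s) e)
⊆∧card⇒≡ (outside ∷ x) (inside  ∷ y) s e =
  ⊥-elim (ℕ.<-irrefl (sym e) (s≤s (p⊆q⇒∣p∣≤∣q∣ (drop-∷-⊆ s))))
⊆∧card⇒≡ (inside  ∷ x) (outside ∷ y) s e with () ← s here
⊆∧card⇒≡ (inside  ∷ x) (inside  ∷ y) s e = cong (inside ∷_) (⊆∧card⇒≡ x y (drop-∷-⊆ s) (ℕ.suc-injective e))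

covers⁺ : (x y : Subset n) → x ⊆ y → ∣ y ∣ ≡ suc ∣ x ∣ → covers x y ≡ true
covers⁺ []            []            _ ()
covers⁺ (outside ∷ x) (outside ∷ y) s e = covers⁺ x y (drop-∷-⊆ s) e
covers⁺ (outside ∷ x) (inside  ∷ y) s e
  with refl ← ⊆∧card⇒≡ x y (drop-∷-⊆ s) (ℕ.suc-injective e) = ⟨⟩-self x
covers⁺ (inside  ∷ x) (outside ∷ y) s e with () ← s here
covers⁺ (inside  ∷ x) (inside  ∷ y) s e = covers⁺ x y (drop-∷-⊆ s) (ℕ.suc-injective e)

covers⁻ : (x y : Subset n) → covers x y ≡ true → x ⊆ y × ∣ y ∣ ≡ suc ∣ x ∣
covers⁻ []            []            ()
covers⁻ (outside ∷ x) (outside ∷ y) e = let s , c = covers⁻ x y e in out⊆ s , c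
covers⁻ (outside ∷ x) (inside  ∷ y) e =
  ⟨⟩-graded (λ z → outside ∷ z ⊆ inside ∷ y × suc ∣ y ∣ ≡ suc ∣ z ∣) y (out⊆ ⊆-refl , refl) x e
covers⁻ (inside  ∷ x) (inside  ∷ y) e = let s , c = covers⁻ x y e in s⊆s s , cong suc c

-- The sum counts, mod 2, the sets strictly between `x` and `y` in a chain of two one-vertex
-- additions. If the first vertex is one of those added, it comes either last or first; each order
-- contributes `covers x y`, and the two cancel. If the first entries agree, induction applies.
covers-square : (x y : Subset n) → ⨁ (λ ρ → covers x ρ ∧ covers ρ y) ≡ false
covers-square []            []            = refl
covers-square (outside ∷ x) (outside ∷ y) =
  cong₂ _xor_ (covers-square x y) (⨁-false (λ ρ → ∧-zeroʳ (⟨ ρ ⟩ x)))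
covers-square (outside ∷ x) (inside  ∷ y) = trans
  (cong₂ _xor_
    (trans (⨁-cong (λ ρ → ∧-comm (covers x ρ) (⟨ y ⟩ ρ))) (⨁-⟨⟩ y (covers x)))
    (trans (⨁-cong (λ ρ → cong (_∧ covers ρ y) (⟨⟩-sym x ρ))) (⨁-⟨⟩ x (λ ρ → covers ρ y))))
  (xor-same (covers x y))
covers-square (inside ∷ x) (outside ∷ y) =
  cong₂ _xor_ (⨁-false {g = λ ρ → false ∧ covers ρ y} (λ ρ → refl)) (⨁-false (λ ρ → ∧-zeroʳ (covers x ρ)))
covers-square (inside ∷ x) (inside ∷ y) =
  cong₂ _xor_ (⨁-false {g = λ ρ → false ∧ ⟨ y ⟩ ρ} (λ ρ → refl)) (covers-square x y)

i+1-1≡i : ∀ i → i + 1ℤ - 1ℤ ≡ i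
i+1-1≡i i = trans (ℤ.+-assoc i 1ℤ -1ℤ) (ℤ.+-identityʳ i)

i-1+1≡i : ∀ i → i - 1ℤ + 1ℤ ≡ i
i-1+1≡i i = trans (ℤ.+-assoc i -1ℤ 1ℤ) (ℤ.+-identityʳ i)

card⇒dim⁺ : {x y : Subset n} → ∣ y ∣ ≡ suc ∣ x ∣ → dim y ≡ dim x + 1ℤ
card⇒dim⁺ {x = x} e rewrite e = sym (i-1+1≡i (+ ∣ x ∣))

card⇒dim⁻ : {x y : Subset n} → ∣ y ∣ ≡ suc ∣ x ∣ → dim x ≡ dim y - 1ℤ
card⇒dim⁻ e rewrite e = refl

dim⁺⇒card : {x y : Subset n} → dim y ≡ dim x + 1ℤ → ∣ y ∣ ≡ suc ∣ x ∣
dim⁺⇒card {x = x} {y} e = trans (ℤ.+-injective (begin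
  + ∣ y ∣              ≡⟨ i-1+1≡i (+ ∣ y ∣) ⟨
  dim y + 1ℤ           ≡⟨ cong (_+ 1ℤ) e ⟩
  dim x + 1ℤ + 1ℤ      ≡⟨ cong (_+ 1ℤ) (i-1+1≡i (+ ∣ x ∣)) ⟩
  + ∣ x ∣ + 1ℤ         ∎)) (ℕ.+-comm ∣ x ∣ 1)
  where open ≡-Reasoning

dim⁻⇒dim⁺ : {x y : Subset n} → dim x ≡ dim y - 1ℤ → dim y ≡ dim x + 1ℤ
dim⁻⇒dim⁺ {y = y} e = sym (trans (cong (_+ 1ℤ) e) (i-1+1≡i (dim y)))

dim⁺⇒≢ : {x y : Subset n} → dim y ≡ dim x + 1ℤ → x ≢ y
dim⁺⇒≢ {x = x} e refl = ℕ.1+n≢n (sym (dim⁺⇒card {x = x} {x} e))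

∂ˢ-covers : (K : SimplicialComplex n) (σ ρ : Subset n) → ∂ˢ K σ ρ ≡ simplices K ρ ∧ covers ρ σ
∂ˢ-covers K σ ρ = ⇔→≡ {z = true} (mk⇔
  (λ e → let ρ∈ , s , d = ∈∂ˢ⁻ K σ e in
     cong₂ _∧_ ρ∈ (covers⁺ ρ σ s (dim⁺⇒card {x = ρ} {σ} (dim⁻⇒dim⁺ {x = ρ} {σ} d))))
  (λ e → let s , c = covers⁻ ρ σ (∧-conicalʳ (simplices K ρ) _ e) in
     ∈∂ˢ⁺ K (∧-conicalˡ (simplices K ρ) _ e) s (card⇒dim⁻ {x = ρ} {σ} c)))

δˢ-covers : (K : SimplicialComplex n) (σ ρ : Subset n) → δˢ K σ ρ ≡ simplices K ρ ∧ covers σ ρ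
δˢ-covers K σ ρ = ⇔→≡ {z = true} (mk⇔
  (λ e → let ρ∈ , s , d = ∈δˢ⁻ K σ e in cong₂ _∧_ ρ∈ (covers⁺ σ ρ s (dim⁺⇒card {x = σ} {ρ} d)))
  (λ e → let s , c = covers⁻ σ ρ (∧-conicalʳ (simplices K ρ) _ e) in
     ∈δˢ⁺ K (∧-conicalˡ (simplices K ρ) _ e) s (card⇒dim⁺ {x = σ} {ρ} c)))

-- The last hypothesis makes the condition ρ ∈ K redundant in the sum over ρ.
masked-square : (K : SimplicialComplex n) (E : Subset n → Subset n → Bool) (D : Subset n → Chain n) →
                (∀ σ ρ → D σ ρ ≡ simplices K ρ ∧ E σ ρ) →
                (∀ σ x → ⨁ (λ ρ → E σ ρ ∧ E ρ x) ≡ false) →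
                (∀ σ ρ x → σ ∈ K → x ∈ K → E σ ρ ≡ true → E ρ x ≡ true → ρ ∈ K) →
                ∀ σ → σ ∈ K → lin D (D σ) ≗ 0ᶜ
masked-square K E D D≡ E² convex σ σ∈ x = begin
  ⨁ (λ ρ → D σ ρ ∧ D ρ x)
    ≡⟨ ⨁-cong (λ ρ → cong₂ _∧_ (D≡ σ ρ) (D≡ ρ x)) ⟩
  ⨁ (λ ρ → (simplices K ρ ∧ E σ ρ) ∧ (simplices K x ∧ E ρ x))
    ≡⟨ ⨁-cong (λ ρ → drop (simplices K ρ) (E σ ρ) (simplices K x) (E ρ x) (convex σ ρ x σ∈)) ⟩
  ⨁ (λ ρ → simplices K x ∧ (E σ ρ ∧ E ρ x))
    ≡⟨ ⨁-∧ˡ (simplices K x) (λ ρ → E σ ρ ∧ E ρ x) ⟩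
  simplices K x ∧ ⨁ (λ ρ → E σ ρ ∧ E ρ x)
    ≡⟨ cong (simplices K x ∧_) (E² σ x) ⟩
  simplices K x ∧ false
    ≡⟨ ∧-zeroʳ (simplices K x) ⟩
  false ∎
  where
  open ≡-Reasoning
  drop : ∀ a b c d → (c ≡ true → b ≡ true → d ≡ true → a ≡ true) → (a ∧ b) ∧ (c ∧ d) ≡ c ∧ (b ∧ d)
  drop a false c     d     h rewrite ∧-zeroʳ a = sym (∧-zeroʳ c)
  drop a true  false d     h = ∧-zeroʳ (a ∧ true)
  drop a true  true  false h = ∧-zeroʳ (a ∧ true)
  drop a true  true  true  h rewrite h refl refl refl = refl

-- Intermediate sets stay in `K`: for `∂`, a set between `x` and `σ` is a face of `σ`, non-empty
-- because it contains `x`; for `δ`, `σ` and `x` exchange roles.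
∂∂≗0 : (K : SimplicialComplex n) (σ : Subset n) → σ ∈ K → lin (∂ˢ K) (∂ˢ K σ) ≗ 0ᶜ
∂∂≗0 K = masked-square K (λ σ ρ → covers ρ σ) (∂ˢ K) (∂ˢ-covers K)
  (λ σ x → trans (⨁-cong (λ ρ → ∧-comm (covers ρ σ) (covers x ρ))) (covers-square x σ))
  (λ σ ρ x σ∈ x∈ ρσ xρ → let v , v∈ = nonempty K x∈ in
     closed K σ∈ (proj₁ (covers⁻ ρ σ ρσ)) (v , proj₁ (covers⁻ x ρ xρ) v∈))

δδ≗0 : (K : SimplicialComplex n) (σ : Subset n) → σ ∈ K → lin (δˢ K) (δˢ K σ) ≗ 0ᶜ
δδ≗0 K = masked-square K covers (δˢ K) (δˢ-covers K) covers-square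
  (λ σ ρ x σ∈ x∈ σρ ρx → let v , v∈ = nonempty K σ∈ in
     closed K x∈ (proj₁ (covers⁻ ρ x ρx)) (v , proj₁ (covers⁻ σ ρ σρ) v∈))

-- Matchings compatible with an order

data Step (n : ℕ) : Set where
  critical : (ν : Subset n) → Step n
  matched  : (source target : Subset n) → Step n

-- The head of a list is its latest step; for costeps, the earliest of the
-- Morse sequence.
Cell Crit Target : List (Step n) → Subset n → Set
Cell []                ρ = ⊥
Cell (critical ν ∷ s)  ρ = ρ ≡ ν ⊎ Cell s ρ
Cell (matched σ τ ∷ s) ρ = ρ ≡ σ ⊎ ρ ≡ τ ⊎ Cell s ρ

Crit []                ρ = ⊥
Crit (critical ν ∷ s)  ρ = ρ ≡ ν ⊎ Crit s ρ
Crit (matched _ _ ∷ s) ρ = Crit s ρ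

Target []                ρ = ⊥
Target (critical _ ∷ s)  ρ = Target s ρ
Target (matched _ τ ∷ s) ρ = ρ ≡ τ ⊎ Target s ρ

-- In matrix terms: with targets and sources ordered along the list, the block of `D` from targets
-- to sources is triangular with ones on the diagonal.
data Acyclic (D : Subset n → Chain n) : List (Step n) → Set where
  []       : Acyclic D []
  critical : ∀ {ν s} → Acyclic D s → Acyclic D (critical ν ∷ s)
  matched  : ∀ {σ τ s} → ¬ Cell s σ → σ ∈ᶠ D τ → (∀ ρ → ρ ∈ᶠ D τ → ρ ≢ σ → Cell s ρ) →
             Acyclic D s → Acyclic D (matched σ τ ∷ s)

target⇒cell : (s : List (Step n)) {ρ : Subset n} → Target s ρ → Cell s ρ
target⇒cell (critical _ ∷ s)  t        = inj₂ (target⇒cell s t)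
target⇒cell (matched _ _ ∷ s) (inj₁ e) = inj₂ (inj₁ e)
target⇒cell (matched _ _ ∷ s) (inj₂ t) = inj₂ (inj₂ (target⇒cell s t))

module _ {D : Subset n → Chain n} where

  -- This gives the zero half of the triangular block: a source listed later is not a cell of `s`,
  -- so it cannot occur in the boundary of a target of `s`.
  target-boundary : {s : List (Step n)} → Acyclic D s → ∀ {τ} → Target s τ → ∀ ρ → ρ ∈ᶠ D τ → Cell s ρ
  target-boundary (critical a) t ρ ρ∈ = inj₂ (target-boundary a t ρ ρ∈)
  target-boundary (matched {σ = σ} _ _ faces _) (inj₁ refl) ρ ρ∈ with ρ ≟ˢ σ
  ... | yes ρ≡σ = inj₁ ρ≡σ
  ... | no ρ≢σ  = inj₂ (inj₂ (faces ρ ρ∈ ρ≢σ))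
  target-boundary (matched _ _ _ a) (inj₂ t) ρ ρ∈ = inj₂ (inj₂ (target-boundary a t ρ ρ∈))

  -- The source of the latest target in c lies in the boundary of no other
  -- target in c.
  target-cycle : {s : List (Step n)} → Acyclic D s → (c : Chain n) →
                 (∀ ρ → ρ ∈ᶠ c → Target s ρ) → lin D c ≗ 0ᶜ → c ≗ 0ᶜ
  target-cycle [] c supp z x with c x in e
  ... | false = refl
  ... | true  = ⊥-elim (supp x e)
  target-cycle (critical a) c supp z = target-cycle a c supp z
  target-cycle {s = matched σ τ ∷ s} (matched σ∉ σ∈Dτ _ a) c supp z = target-cycle a c supp′ z
    where
    other : ∀ ρ → ρ ≢ τ → c ρ ∧ D ρ σ ≡ false
    other ρ ρ≢τ with c ρ in cρ | D ρ σ in Dρσ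
    ... | false | _     = refl
    ... | true  | false = refl
    ... | true  | true with supp ρ cρ
    ...   | inj₁ ρ≡τ = ⊥-elim (ρ≢τ ρ≡τ)
    ...   | inj₂ t   = ⊥-elim (σ∉ (target-boundary a t σ Dρσ))
    cτ : c τ ≡ false
    cτ = begin
      c τ         ≡⟨ ∧-identityʳ (c τ) ⟨
      c τ ∧ true  ≡⟨ cong (c τ ∧_) σ∈Dτ ⟨
      c τ ∧ D τ σ ≡⟨ ⨁-single τ (λ ρ → c ρ ∧ D ρ σ) other ⟨
      lin D c σ   ≡⟨ z σ ⟩
      false       ∎
      where open ≡-Reasoning
    supp′ : ∀ ρ → ρ ∈ᶠ c → Target s ρ
    supp′ ρ ρ∈ with supp ρ ρ∈
    ... | inj₂ t    = t
    ... | inj₁ refl with () ← trans (sym cτ) ρ∈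

  -- Both sides vanish on the boundary of a target and agree, inductively, on
  -- all its simplices but the source.
  reference-boundary : (r : Subset n → Chain n) {s : List (Step n)} → Acyclic D s →
    (∀ ν → Crit s ν → r ν ≗ ⟨ ν ⟩) →
    (∀ τ → Target s τ → r τ ≗ 0ᶜ) →
    (∀ τ → Target s τ → lin r (D τ) ≗ 0ᶜ) →
    (∀ τ → Target s τ → lin D (D τ) ≗ 0ᶜ) →
    ∀ ρ → Cell s ρ → lin r (D ρ) ≗ lin r (lin D (r ρ))
  reference-boundary r (critical a) rc rt rDt DD ρ (inj₁ refl) =
    lin-cong r λ x → sym (trans (lin-cong D (rc ρ (inj₁ refl)) x) (lin-⟨⟩ D ρ x))
  reference-boundary r (critical a) rc rt rDt DD ρ (inj₂ c) =
    reference-boundary r a (λ ν → rc ν ∘ inj₂) rt rDt DD ρ c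
  reference-boundary r {s = matched σ τ ∷ s} (matched _ σ∈Dτ faces a) rc rt rDt DD = λ where
      ρ (inj₁ refl)        → lin-solve G H (D τ) σ σ∈Dτ (λ x → trans (G0 x) (sym (H0 x)))
                               (λ π π∈ π≢σ → older π (faces π π∈ π≢σ))
      ρ (inj₂ (inj₁ refl)) x → trans (rDt τ (inj₁ refl) x)
                               (sym (lin-0 r (lin-0 D (rt τ (inj₁ refl))) x))
      ρ (inj₂ (inj₂ c))    → older ρ c
    where
    G H : Subset n → Chain n
    G ρ = lin r (D ρ)
    H ρ = lin r (lin D (r ρ))
    older : ∀ ρ → Cell s ρ → G ρ ≗ H ρ
    older = reference-boundary r a rc (λ τ → rt τ ∘ inj₂) (λ τ → rDt τ ∘ inj₂) (λ τ → DD τ ∘ inj₂)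
    G0 : lin G (D τ) ≗ 0ᶜ
    G0 x = trans (sym (lin-lin r D (D τ) x)) (lin-0 r (DD τ (inj₁ refl)) x)
    H0 : lin H (D τ) ≗ 0ᶜ
    H0 x = begin
      lin H (D τ) x                            ≡⟨ lin-lin r (λ ρ → lin D (r ρ)) (D τ) x ⟨
      lin r (lin (λ ρ → lin D (r ρ)) (D τ)) x  ≡⟨ lin-cong r (lin-lin D r (D τ)) x ⟨
      lin r (lin D (lin r (D τ))) x            ≡⟨ lin-0 r (lin-0 D (rDt τ (inj₁ refl))) x ⟩
      false                                    ∎
      where open ≡-Reasoning

  -- The sum of `Q` and the image of `P` under `D`, that is, the chains congruent to an element of
  -- `Q` modulo boundaries from `P`. Being a subspace, it is amenable to `lin-closed`.
  Reducible : Subspace n → Subspace n → Subspace n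
  Reducible P Q = record
    { Mem   = λ c → ∃ λ u → Mem P u × Mem Q (c ⊕ lin D u)
    ; resp  = λ e (u , p , q) → u , p , resp Q (λ x → cong (_xor lin D u x) (e x)) q
    ; zero∈ = 0ᶜ , zero∈ P , resp Q (λ x → sym (app-0 (extend D) x)) (zero∈ Q)
    ; add∈  = λ {c} {d} (u , p , q) (v , p′ , q′) → u ⊕ v , add∈ P p p′ ,
        resp Q (λ x → trans (xor-interchange (c x) (lin D u x) (d x) (lin D v x))
                            (cong ((c x xor d x) xor_) (sym (lin-⊕ D u v x))))
               (add∈ Q q q′)
    }

  module _ (P Q : Subspace n) where

    irreducible : ∀ {c} → Mem Q c → Mem (Reducible P Q) c
    irreducible {c} q = 0ᶜ , zero∈ P ,
      resp Q (λ x → sym (trans (cong (c x xor_) (app-0 (extend D) x)) (xor-identityʳ (c x)))) q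

    -- Recursion down the list. Critical simplices and targets are already in `Q`; a source `σ` is
    -- congruent modulo `D τ` to the rest of `D τ`, which was listed earlier. The predicate `X`
    -- carries the degree: a boundary that meets `X` lies in it entirely.
    reduce : (X : Subset n → Set) {s : List (Step n)} → Acyclic D s →
             (∀ ν → Crit s ν → X ν → Mem Q ⟨ ν ⟩) →
             (∀ τ → Target s τ → X τ → Mem Q ⟨ τ ⟩) →
             (∀ τ ρ → Target s τ → ρ ∈ᶠ D τ → X ρ → Mem P ⟨ τ ⟩ × (∀ π → π ∈ᶠ D τ → X π)) →
             ∀ ρ → Cell s ρ → X ρ → Mem (Reducible P Q) ⟨ ρ ⟩
    reduce X (critical a) qc qt pt ρ (inj₁ refl) Xρ = irreducible (qc ρ (inj₁ refl) Xρ)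
    reduce X (critical a) qc qt pt ρ (inj₂ c)    Xρ = reduce X a (λ ν → qc ν ∘ inj₂) qt pt ρ c Xρ
    reduce X (matched _ _ _ _) qc qt pt ρ (inj₂ (inj₁ refl)) Xρ = irreducible (qt ρ (inj₁ refl) Xρ)
    reduce X (matched _ _ _ a) qc qt pt ρ (inj₂ (inj₂ c)) Xρ =
      reduce X a qc (λ τ → qt τ ∘ inj₂) (λ τ π → pt τ π ∘ inj₂) ρ c Xρ
    reduce X (matched {σ = σ} {τ} _ σ∈Dτ faces a) qc qt pt ρ (inj₁ refl) Xσ =
      resp (Reducible P Q) restore (add∈ (Reducible P Q) {D τ} {lin ⟨_⟩ (D τ ⊕ ⟨ σ ⟩)} boundary others)
      where
      R = Reducible P Q
      others : Mem R (lin ⟨_⟩ (D τ ⊕ ⟨ σ ⟩))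
      others = lin-closed R ⟨_⟩ (D τ ⊕ ⟨ σ ⟩) older
        where
        older : ∀ π → π ∈ᶠ (D τ ⊕ ⟨ σ ⟩) → Mem R ⟨ π ⟩
        older π e with π ≟ˢ σ
        -- `σ` occurs both in `D τ` and in `⟨ σ ⟩`, so it cancels mod 2.
        ... | yes refl with () ← trans (sym e) (cong (_xor true) σ∈Dτ)
        ... | no π≢σ = reduce X a qc (λ τ → qt τ ∘ inj₂) (λ τ π → pt τ π ∘ inj₂) π (faces π π∈ π≢σ)
                         (proj₂ (pt τ σ (inj₁ refl) σ∈Dτ Xσ) π π∈)
          where π∈ = trans (sym (xor-identityʳ (D τ π))) e
      boundary : Mem R (D τ)
      -- `D τ` reduces to zero, with `⟨ τ ⟩` as the chain whose boundary is added.
      boundary = ⟨ τ ⟩ , proj₁ (pt τ σ (inj₁ refl) σ∈Dτ Xσ) ,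
        resp Q (λ x → sym (⊕-self (λ y → sym (lin-⟨⟩ D τ y)) x)) (zero∈ Q)
      restore : D τ ⊕ lin ⟨_⟩ (D τ ⊕ ⟨ σ ⟩) ≗ ⟨ σ ⟩
      restore x = begin
        D τ x xor lin ⟨_⟩ (D τ ⊕ ⟨ σ ⟩) x ≡⟨ cong (D τ x xor_) (⟨⟩-lin (D τ ⊕ ⟨ σ ⟩) x) ⟩
        D τ x xor (D τ x xor ⟨ σ ⟩ x)     ≡⟨ xor-assoc (D τ x) (D τ x) (⟨ σ ⟩ x) ⟨
        (D τ x xor D τ x) xor ⟨ σ ⟩ x     ≡⟨ cong (_xor ⟨ σ ⟩ x) (xor-same (D τ x)) ⟩
        ⟨ σ ⟩ x                           ∎
        where open ≡-Reasoning

-- The isomorphism on homology induced by the reference map of a matching.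

module MatchingHomology
  -- `down` is the degree shift of `D`: subtraction of one for `∂`, addition of one for `δ`.
  -- Abstracting both shifts makes one statement serve homology and cohomology.
  (K : SimplicialComplex n) (D : Subset n → Chain n) (up down : ℤ → ℤ)
  (up-down : ∀ i → up (down i) ≡ i) (down-up : ∀ i → down (up i) ≡ i)
  (D-graded : ∀ {σ ρ} → ρ ∈ᶠ D σ → ρ ∈ K × dim ρ ≡ down (dim σ))
  (DD≗0 : ∀ σ → σ ∈ K → lin D (D σ) ≗ 0ᶜ)
  (Cr : Subset n → Set) (s : List (Step n)) (acyclic : Acyclic D s)
  (cell⁺ : ∀ {ρ} → ρ ∈ K → Cell s ρ) (cell⁻ : ∀ {ρ} → Cell s ρ → ρ ∈ K)
  (crit⇒Cr : ∀ {ν} → Crit s ν → Cr ν)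
  (r : Subset n → Chain n)
  (r-graded : ∀ σ → σ ∈ K → ∀ x → x ∈ᶠ r σ → (x ∈ K × dim x ≡ dim σ) × Cr x)
  (r-critical : ∀ ν → Cr ν → r ν ≗ ⟨ ν ⟩)
  (r-target : ∀ τ → Target s τ → r τ ≗ 0ᶜ)
  (rD-target : ∀ τ → Target s τ → lin r (D τ) ≗ 0ᶜ)
  where

  -- For `Cr = Critical W` the space `Ŵ p` is definitionally `W ⟦ p ⟧`, so `homology-iso` concerns
  -- the critical and cocritical complexes themselves.
  Ŵ T : ℤ → Subspace n
  Ŵ p = supported λ σ → (σ ∈ K × dim σ ≡ p) × Cr σ
  T p = supported λ σ → Target s σ × dim σ ≡ p

  -- The normal form reached once all sources have been removed by `reduce`.
  N : Subspace n
  N = supported λ σ → Crit s σ ⊎ Target s σ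

  private
    variable
      p : ℤ
      c : Chain n

  Ŵ⊆K : Mem (Ŵ p) c → Mem (K [ p ]) c
  Ŵ⊆K m σ σ∈ = proj₁ (m σ σ∈)

  T⊆K : Mem (T p) c → Mem (K [ p ]) c
  T⊆K m σ σ∈ = let t , d = m σ σ∈ in cell⁻ (target⇒cell s t) , d

  D-lowers : Mem (K [ p ]) c → Mem (K [ down p ]) (lin D c)
  D-lowers {p} {c} m = lin-closed (K [ down p ]) D c λ σ σ∈ ρ ρ∈ →
    let ρ∈K , dρ = D-graded ρ∈ in ρ∈K , trans dρ (cong down (proj₂ (m σ σ∈)))

  D-lowers-up : Mem (K [ up p ]) c → Mem (K [ p ]) (lin D c)
  D-lowers-up {p} {c} m = subst (λ q → Mem (K [ q ]) (lin D c)) (down-up p) (D-lowers m)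

  DD-chain : Mem (K [ p ]) c → lin D (lin D c) ≗ 0ᶜ
  DD-chain {c = c} m x = trans (lin-lin D D c x) (lin-vanish c (λ σ σ∈ → DD≗0 σ (proj₁ (m σ σ∈))) x)

  r-into : Mem (K [ p ]) c → Mem (Ŵ p) (lin r c)
  r-into {p} {c} m = lin-closed (Ŵ p) r c λ σ σ∈ x x∈ →
    let σ∈K , dσ = m σ σ∈
        (x∈K , dx) , cx = r-graded σ σ∈K x x∈
    in (x∈K , trans dx dσ) , cx

  r-fixes : Mem (Ŵ p) c → lin r c ≗ c
  r-fixes {c = c} m x = trans (lin-agree c (λ σ σ∈ → r-critical σ (proj₂ (m σ σ∈))) x) (⟨⟩-lin c x)

  r-kills-T : Mem (T p) c → lin r c ≗ 0ᶜ
  r-kills-T {c = c} m = lin-vanish c (λ σ σ∈ → r-target σ (proj₁ (m σ σ∈)))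

  r-kills-DT : Mem (T p) c → lin r (lin D c) ≗ 0ᶜ
  r-kills-DT {c = c} m x =
    trans (lin-lin r D c x) (lin-vanish c (λ σ σ∈ → rD-target σ (proj₁ (m σ σ∈))) x)

  -- The linear extension of `reference-boundary`. It makes `lin r` a chain map from `D` to the
  -- critical differential, which is `D` followed by `r`.
  rD≗rDr : Mem (K [ p ]) c → lin r (lin D c) ≗ lin r (lin D (lin r c))
  rD≗rDr {c = c} m x = begin
    lin r (lin D c) x                      ≡⟨ lin-lin r D c x ⟩
    lin (λ σ → lin r (D σ)) c x            ≡⟨ lin-agree c (λ σ σ∈ → on-simplex σ (cell⁺ (proj₁ (m σ σ∈)))) x ⟩
    lin (λ σ → lin r (lin D (r σ))) c x    ≡⟨ lin-lin r (λ σ → lin D (r σ)) c x ⟨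
    lin r (lin (λ σ → lin D (r σ)) c) x    ≡⟨ lin-cong r (lin-lin D r c) x ⟨
    lin r (lin D (lin r c)) x              ∎
    where
    open ≡-Reasoning
    on-simplex = reference-boundary r acyclic (λ ν → r-critical ν ∘ crit⇒Cr) r-target rD-target
                   (λ τ t → DD≗0 τ (cell⁻ (target⇒cell s t)))

  reducible : Mem (K [ p ]) c → Mem (Reducible {D = D} (T (up p)) N) c
  reducible {p} {c} m = resp R {lin ⟨_⟩ c} {c} (⟨⟩-lin c) (lin-closed R ⟨_⟩ c λ σ σ∈ →
      let σ∈K , dσ = m σ σ∈ in reduce (T (up p)) N (λ ρ → dim ρ ≡ p) acyclic
        (λ ν cν _ → ⟨⟩-graded _ ν (inj₁ cν))
        (λ τ tτ _ → ⟨⟩-graded _ τ (inj₂ tτ))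
        (λ τ ρ tτ ρ∈ dρ →
           -- A target with one boundary simplex of dimension `p` has dimension `up p`, hence all
           -- its boundary simplices have dimension `p`.
           let dτ = trans (sym (up-down (dim τ))) (cong up (trans (sym (proj₂ (D-graded ρ∈))) dρ))
           in ⟨⟩-graded _ τ (tτ , dτ) ,
              λ π π∈ → trans (proj₂ (D-graded π∈)) (trans (cong down dτ) (down-up p)))
        σ (cell⁺ σ∈K) dσ)
    where R = Reducible {D = D} (T (up p)) N

  -- On `N` the map `r` fixes critical simplices and kills targets, so a critical simplex of `c`
  -- would survive in `lin r c`.
  kernel-in-T : Mem N c → lin r c ≗ 0ᶜ → ∀ ρ → ρ ∈ᶠ c → Target s ρ
  kernel-in-T {c} m z ρ ρ∈ with m ρ ρ∈
  ... | inj₂ t  = t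
  ... | inj₁ cρ = contradiction (trans (sym (z ρ)) rcρ) λ ()
    where
    other : ∀ σ → σ ≢ ρ → c σ ∧ r σ ρ ≡ false
    other σ σ≢ρ with c σ in cσ
    ... | false = refl
    ... | true with m σ cσ
    ...   | inj₁ cr = trans (r-critical σ (crit⇒Cr cr) ρ) (⟨⟩-≢ (σ≢ρ ∘ sym))
    ...   | inj₂ t  = r-target σ t ρ
    rcρ : lin r c ρ ≡ true
    rcρ = trans (⨁-single ρ (λ σ → c σ ∧ r σ ρ) other)
                (cong₂ _∧_ ρ∈ (trans (r-critical ρ (crit⇒Cr cρ) ρ) (⟨⟩-self ρ)))

  -- Adding `lin D u` removes the sources and preserves both hypotheses, since `r` kills boundaries
  -- of targets. What remains is a cycle of targets, zero by `target-cycle`. The bounding chain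
  -- consists of targets, so `lin r` kills it too; surjectivity relies on that.
  kernel-acyclic : Mem (K [ p ]) c → lin D c ≗ 0ᶜ → lin r c ≗ 0ᶜ →
                   ∃ λ u → Mem (T (up p)) u × lin D u ≗ c
  kernel-acyclic {p} {c} m Dc rc =
    let u , u∈T , q = reducible m
        e = lin D u
        rce : lin r (c ⊕ e) ≗ 0ᶜ
        rce x = trans (lin-⊕ r c e x) (⊕-zeros rc (r-kills-DT u∈T) x)
        Dce : lin D (c ⊕ e) ≗ 0ᶜ
        Dce x = trans (lin-⊕ D c e x) (⊕-zeros Dc (DD-chain (T⊆K u∈T)) x)
        ce≗0 = target-cycle acyclic (c ⊕ e) (kernel-in-T q rce) Dce
    in u , u∈T , λ x → sym (xor≡false⇒≡ (c x) (e x) (ce≗0 x))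

  homology-iso : ∀ p →
    ker (extend D) (K [ p ]) / im (extend D) (K [ up p ]) ≅
    ker (extend r ∘ₗ extend D) (Ŵ p) / im (extend r ∘ₗ extend D) (Ŵ (up p))
  homology-iso p = φ , record
    { isModuleMonomorphism = record
      { isModuleHomomorphism = record { isBimoduleHomomorphism = record
        { +ᴹ-isGroupHomomorphism = record
          { isMonoidHomomorphism = record
            { isMagmaHomomorphism = record
              { isRelHomomorphism = record { cong = λ {z} {w} → φ-cong z w }
              ; homo = λ (c , _) (d , _) → ≗⇒≈ (lin-⊕ r c d)
              }
            ; ε-homo = ≗⇒≈ (app-0 (extend r))
            }
          ; ⁻¹-homo = λ (c , _) → ≗⇒≈ {lin r c} (λ _ → refl)
          }
        ; *ₗ-homo = λ b (c , _) → ≗⇒≈ (scale b c)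
        ; *ᵣ-homo = λ b (c , _) → ≗⇒≈ (scale b c)
        } }
      ; injective = λ {z} {w} → φ-injective z w
      }
    ; surjective = λ y → let x , e = φ-surjective y in
        x , λ {z} z≈x → Module.≈ᴹ-trans Q {φ z} {φ x} {y} (φ-cong z x z≈x) (≗⇒≈ e)
    }
    where
    M = ker (extend D) (K [ p ]) / im (extend D) (K [ up p ])
    B = im (extend r ∘ₗ extend D) (Ŵ (up p))
    Q = ker (extend r ∘ₗ extend D) (Ŵ p) / B
    open Module M using () renaming (Carrierᴹ to Z; _≈ᴹ_ to _≈₁_)
    open Module Q using () renaming (Carrierᴹ to Ẑ; _≈ᴹ_ to _≈₂_)

    ≗⇒≈ : {c d : Chain n} → c ≗ d → Mem B (c ⊕ d)
    ≗⇒≈ e = resp B (λ x → sym (⊕-self e x)) (zero∈ B)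

    scale : ∀ b c → lin r (λ σ → b ∧ c σ) ≗ λ x → b ∧ lin r c x
    scale true  c x = refl
    scale false c x = app-0 (extend r) x

    φ : Z → Ẑ
    φ (c , m , z) = lin r c , r-into m , λ x → trans (sym (rD≗rDr m x)) (lin-0 r z x)

    φ-cong : ∀ z w → z ≈₁ w → φ z ≈₂ φ w
    φ-cong (c , _) (d , _) (e , m , De) = lin r e , r-into m , λ x → begin
      lin r (lin D (lin r e)) x ≡⟨ rD≗rDr m x ⟨
      lin r (lin D e) x         ≡⟨ lin-cong r De x ⟩
      lin r (c ⊕ d) x           ≡⟨ lin-⊕ r c d x ⟩
      lin r c x xor lin r d x   ∎
      where open ≡-Reasoning

    φ-injective : ∀ z w → φ z ≈₂ φ w → z ≈₁ w
    φ-injective (c , m , Dc) (d , m′ , Dd) (w , w∈ , rDw) =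
      -- By hypothesis `lin r` takes `c ⊕ d` and `lin D w` to the same chain, so their sum is a
      -- cycle in the kernel of `lin r` and equals `lin D u`. Hence `u ⊕ w` bounds `c ⊕ d`.
      let u , u∈ , Du = kernel-acyclic (add∈ (K [ p ]) {c ⊕ d} {lin D w} cd∈ (D-lowers-up (Ŵ⊆K w∈)))
            (λ x → trans (lin-⊕ D (c ⊕ d) (lin D w) x) (⊕-zeros Dcd (DD-chain (Ŵ⊆K w∈)) x))
            (λ x → trans (lin-⊕ r (c ⊕ d) (lin D w) x)
                     (⊕-self (λ y → trans (lin-⊕ r c d y) (sym (rDw y))) x))
      in u ⊕ w , add∈ (K [ up p ]) {u} {w} (T⊆K u∈) (Ŵ⊆K w∈) , λ x → begin
           lin D (u ⊕ w) x                                  ≡⟨ lin-⊕ D u w x ⟩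
           lin D u x xor lin D w x                          ≡⟨ cong (_xor lin D w x) (Du x) ⟩
           ((c ⊕ d) x xor lin D w x) xor lin D w x          ≡⟨ xor-assoc ((c ⊕ d) x) (lin D w x) (lin D w x) ⟩
           (c ⊕ d) x xor (lin D w x xor lin D w x)          ≡⟨ cong ((c ⊕ d) x xor_) (xor-same (lin D w x)) ⟩
           (c ⊕ d) x xor false                              ≡⟨ xor-identityʳ ((c ⊕ d) x) ⟩
           (c ⊕ d) x                                        ∎
      where
      open ≡-Reasoning
      cd∈ : Mem (K [ p ]) (c ⊕ d)
      cd∈ = add∈ (K [ p ]) {c} {d} m m′
      Dcd : lin D (c ⊕ d) ≗ 0ᶜ
      Dcd x = trans (lin-⊕ D c d x) (⊕-zeros Dc Dd x)

    φ-surjective : ∀ y → ∃ λ x → proj₁ (φ x) ≗ proj₁ y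
    φ-surjective (w , w∈ , rDw) =
      -- A critical cycle `w` need not be a cycle of `K`, but `lin D w` is a cycle killed by
      -- `lin r`, hence the boundary of a chain `u` of targets. Then `w ⊕ u` is a cycle, and `lin r`
      -- sends it to `w`.
      let u , u∈T , Du = kernel-acyclic (D-lowers (Ŵ⊆K w∈)) (DD-chain (Ŵ⊆K w∈)) rDw
          u∈ = subst (λ q → Mem (T q) u) (up-down p) u∈T
      in (w ⊕ u , add∈ (K [ p ]) {w} {u} (Ŵ⊆K w∈) (T⊆K u∈) ,
            λ x → trans (lin-⊕ D w u x) (⊕-self (λ y → sym (Du y)) x)) ,
         λ x → begin
           lin r (w ⊕ u) x         ≡⟨ lin-⊕ r w u x ⟩
           lin r w x xor lin r u x ≡⟨ cong₂ _xor_ (r-fixes w∈ x) (r-kills-T u∈ x) ⟩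
           w x xor false           ≡⟨ xor-identityʳ (w x) ⟩
           w x                     ∎
      where open ≡-Reasoning

-- A Morse sequence as a matching, read in both directions

steps : {L : SimplicialComplex n} → MorseSequence L → List (Step n)
steps (start _)               = []
steps (W ▷ expansion σ τ _ _) = matched σ τ ∷ steps W
steps (W ▷ filling ν _ _)     = critical ν ∷ steps W

steps-cell⁻ : {L : SimplicialComplex n} (W : MorseSequence L) {ρ : Subset n} → Cell (steps W) ρ → ρ ∈ L
steps-cell⁻ (W ▷ expansion _ _ fp _)     (inj₁ refl)        = FreePair.σ∈K fp
steps-cell⁻ (W ▷ expansion _ _ fp _)     (inj₂ (inj₁ refl)) = FreePair.τ∈K fp
steps-cell⁻ (W ▷ s@(expansion _ _ _ _)) (inj₂ (inj₂ c))    = ↗⇒⊑ s (steps-cell⁻ W c)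
steps-cell⁻ (W ▷ filling _ fa _)         (inj₁ refl)        = Facet.ν∈K fa
steps-cell⁻ (W ▷ s@(filling _ _ _))     (inj₂ c)           = ↗⇒⊑ s (steps-cell⁻ W c)

steps-cell⁺ : {L : SimplicialComplex n} (W : MorseSequence L) {ρ : Subset n} → ρ ∈ L → Cell (steps W) ρ
steps-cell⁺ (start e) {ρ} ρ∈ = e ρ ρ∈
steps-cell⁺ (W ▷ expansion σ τ _ d) {ρ} ρ∈ with ρ ≟ˢ σ | ρ ≟ˢ τ
... | yes e  | _      = inj₁ e
... | no _   | yes e  = inj₂ (inj₁ e)
... | no ≢σ  | no ≢τ  = inj₂ (inj₂ (steps-cell⁺ W (Equivalence.from (d ρ) (ρ∈ , ≢σ , ≢τ))))
steps-cell⁺ (W ▷ filling ν _ d) {ρ} ρ∈ with ρ ≟ˢ ν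
... | yes e = inj₁ e
... | no ≢ν = inj₂ (steps-cell⁺ W (Equivalence.from (d ρ) (ρ∈ , ≢ν)))

steps-crit : {L : SimplicialComplex n} (W : MorseSequence L) {ρ : Subset n} → Crit (steps W) ρ → Critical W ρ
steps-crit (W ▷ expansion _ _ _ _) c = steps-crit W c
steps-crit (W ▷ filling _ _ _)     c = map₂ (steps-crit W) c

steps-target : {L : SimplicialComplex n} (W : MorseSequence L) {ρ : Subset n} →
               Target (steps W) ρ → UpperRegular W ρ
steps-target (W ▷ expansion _ _ _ _) t = map₂ (steps-target W) t
steps-target (W ▷ filling _ _ _)     t = steps-target W t

-- Although `∂ˢ K` refers to the final complex, the faces of `τ` lie in `L` by closure. Those other
-- than `σ` differ from `τ` by dimension and so were present before the expansion.
steps-acyclic : (K : SimplicialComplex n) {L : SimplicialComplex n} → L ⊑ K → (W : MorseSequence L) →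
                Acyclic (∂ˢ K) (steps W)
steps-acyclic K L⊑K (start _) = []
steps-acyclic K {L} L⊑K (W ▷ s@(expansion σ τ fp d)) = matched
  (λ c → proj₁ (proj₂ (Equivalence.to (d σ) (steps-cell⁻ W c))) refl)
  (∈∂ˢ⁺ K (L⊑K σ∈K) (proj₁ σ⊂τ) (freePair-dim⁻ fp))
  (λ ρ ρ∈ ρ≢σ → let ρ∈K , ρ⊆τ , dρ = ∈∂ˢ⁻ K τ ρ∈ in
     steps-cell⁺ W (Equivalence.from (d ρ)
       (closed L τ∈K ρ⊆τ (nonempty K ρ∈K) , ρ≢σ , dim⁺⇒≢ (dim⁻⇒dim⁺ {x = ρ} {τ} dρ))))
  (steps-acyclic K (λ ρ∈ → L⊑K (↗⇒⊑ s ρ∈)) W)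
  where open FreePair fp
steps-acyclic K L⊑K (W ▷ s@(filling _ _ _)) = critical (steps-acyclic K (λ ρ∈ → L⊑K (↗⇒⊑ s ρ∈)) W)

-- The accumulator reverses the order. The upper simplex `τ` becomes the source, since it lies in
-- the coboundary of `σ`.
costeps : {L : SimplicialComplex n} → MorseSequence L → List (Step n) → List (Step n)
costeps (start _)               s = s
costeps (W ▷ expansion σ τ _ _) s = costeps W (matched τ σ ∷ s)
costeps (W ▷ filling ν _ _)     s = costeps W (critical ν ∷ s)

costeps-crit : {L : SimplicialComplex n} (W : MorseSequence L) (s : List (Step n)) {ρ : Subset n} →
               Crit (costeps W s) ρ → Critical W ρ ⊎ Crit s ρ
costeps-crit (start _) s c = inj₂ c
costeps-crit (W ▷ expansion σ τ _ _) s c = costeps-crit W (matched τ σ ∷ s) c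
costeps-crit (W ▷ filling ν _ _) s c with costeps-crit W (critical ν ∷ s) c
... | inj₁ c′        = inj₁ (inj₂ c′)
... | inj₂ (inj₁ e)  = inj₁ (inj₁ e)
... | inj₂ (inj₂ c′) = inj₂ c′

costeps-target : {L : SimplicialComplex n} (W : MorseSequence L) (s : List (Step n)) {ρ : Subset n} →
                 Target (costeps W s) ρ → LowerRegular W ρ ⊎ Target s ρ
costeps-target (start _) s t = inj₂ t
costeps-target (W ▷ expansion σ τ _ _) s t with costeps-target W (matched τ σ ∷ s) t
... | inj₁ t′        = inj₁ (inj₂ t′)
... | inj₂ (inj₁ e)  = inj₁ (inj₁ e)
... | inj₂ (inj₂ t′) = inj₂ t′
costeps-target (W ▷ filling ν _ _) s t = costeps-target W (critical ν ∷ s) t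

-- The invariant of the backward reading: `s` lists what has been read, and `L` is what is left.
record Comatching (K L : SimplicialComplex n) (s : List (Step n)) : Set where
  field
    cell⁻   : ∀ {ρ} → Cell s ρ → ρ ∈ K × ρ ∉ L
    cell⁺   : ∀ {ρ} → ρ ∈ K → ρ ∉ L → Cell s ρ
    acyclic : Acyclic (δˢ K) s

-- `start` accepts any complex without simplices, so the one at which the reading ends is returned
-- as `L₀`.
costeps-comatching : (K : SimplicialComplex n) {L : SimplicialComplex n} → L ⊑ K → (W : MorseSequence L)
                     (s : List (Step n)) → Comatching K L s →
                     ∃ λ L₀ → (∀ σ → σ ∉ L₀) × Comatching K L₀ (costeps W s)
costeps-comatching K L⊑K (start {L₀} e) s C = L₀ , e , C
costeps-comatching K {L} L⊑K (_▷_ {L = L′} W e@(expansion σ τ fp d)) s C =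
  costeps-comatching K (λ ρ∈ → L⊑K (↗⇒⊑ e ρ∈)) W (matched τ σ ∷ s) record
    { cell⁻ = λ where
        (inj₁ refl)        → L⊑K τ∈K , λ τ∈ → proj₂ (proj₂ (Equivalence.to (d τ) τ∈)) refl
        (inj₂ (inj₁ refl)) → L⊑K σ∈K , λ σ∈ → proj₁ (proj₂ (Equivalence.to (d σ) σ∈)) refl
        (inj₂ (inj₂ c))    → let ρ∈ , ρ∉ = cell⁻ c in ρ∈ , ρ∉ ∘ ↗⇒⊑ e
    ; cell⁺ = visited
    ; acyclic = matched (λ c → proj₂ (cell⁻ c) τ∈K)
        (∈δˢ⁺ K (L⊑K τ∈K) (proj₁ σ⊂τ) (freePair-dim⁺ fp))
        -- Freeness of the pair in `L`: a coface of `σ` other than `τ` is not in `L`, so it was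
        -- added later and is already in `s`.
        (λ ρ ρ∈ ρ≢τ → let ρ∈K , σ⊆ρ , dρ = ∈δˢ⁻ K σ ρ∈ in
           cell⁺ ρ∈K (λ ρ∈L → ρ≢τ (only ρ ρ∈L σ⊆ρ (dim⁺⇒≢ dρ ∘ sym))))
        acyclic
    }
  where
  open FreePair fp
  open Comatching C
  visited : ∀ {ρ} → ρ ∈ K → ρ ∉ L′ → Cell (matched τ σ ∷ s) ρ
  visited {ρ} ρ∈ ρ∉ with ρ ≟ˢ τ | ρ ≟ˢ σ
  ... | yes q | _     = inj₁ q
  ... | no _  | yes q = inj₂ (inj₁ q)
  ... | no ≢τ | no ≢σ = inj₂ (inj₂ (cell⁺ ρ∈ (λ ρ∈L → ρ∉ (Equivalence.from (d ρ) (ρ∈L , ≢σ , ≢τ)))))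
costeps-comatching K {L} L⊑K (_▷_ {L = L′} W e@(filling ν fa d)) s C =
  costeps-comatching K (λ ρ∈ → L⊑K (↗⇒⊑ e ρ∈)) W (critical ν ∷ s) record
    { cell⁻ = λ where
        (inj₁ refl) → L⊑K ν∈K , λ ν∈ → proj₂ (Equivalence.to (d ν) ν∈) refl
        (inj₂ c)    → let ρ∈ , ρ∉ = cell⁻ c in ρ∈ , ρ∉ ∘ ↗⇒⊑ e
    ; cell⁺ = visited
    ; acyclic = critical acyclic
    }
  where
  open Facet fa
  open Comatching C
  visited : ∀ {ρ} → ρ ∈ K → ρ ∉ L′ → Cell (critical ν ∷ s) ρ
  visited {ρ} ρ∈ ρ∉ with ρ ≟ˢ ν
  ... | yes q = inj₁ q
  ... | no ≢ν = inj₂ (cell⁺ ρ∈ (λ ρ∈L → ρ∉ (Equivalence.from (d ρ) (ρ∈L , ≢ν))))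

-- The homology and cohomology isomorphisms of a Morse sequence.

homology≅critical : {K : SimplicialComplex n} (W : MorseSequence K) (p : ℤ) →
                    Homology K p ≅ CriticalHomology W p
homology≅critical {K = K} W = MatchingHomology.homology-iso K (∂ˢ K) (_+ 1ℤ) (_- 1ℤ) i-1+1≡i i+1-1≡i
  (λ {σ} ρ∈ → let ρ∈K , _ , d = ∈∂ˢ⁻ K σ ρ∈ in ρ∈K , d)
  (∂∂≗0 K) (Critical W) (steps W) (steps-acyclic K id W)
  (steps-cell⁺ W) (steps-cell⁻ W) (steps-crit W)
  (reference W) R.graded R.critical
  (λ τ t → R.upper τ (steps-target W t)) (λ τ t → R.upper∂ τ (steps-target W t))
  where module R = IsReferenceMap (reference-isReferenceMap W)

cohomology≅cocritical : {K : SimplicialComplex n} (W : MorseSequence K) (p : ℤ) →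
                        Cohomology K p ≅ CocriticalCohomology W p
cohomology≅cocritical {K = K} W with costeps-comatching K id W []
  -- Nothing has been read yet: the list is empty and `L` is `K` itself.
  record { cell⁻ = λ () ; cell⁺ = λ ρ∈ ρ∉ → ρ∉ ρ∈ ; acyclic = [] }
... | _ , empty , C = MatchingHomology.homology-iso K (δˢ K) (_- 1ℤ) (_+ 1ℤ) i+1-1≡i i-1+1≡i
  (λ {σ} ρ∈ → let ρ∈K , _ , d = ∈δˢ⁻ K σ ρ∈ in ρ∈K , d)
  (δδ≗0 K) (Critical W) (costeps W []) C.acyclic
  (λ {ρ} ρ∈ → C.cell⁺ ρ∈ (empty ρ)) (proj₁ ∘ C.cell⁻) crit
  (coreference W) R.graded R.critical
  (λ σ t → R.lower σ (target t)) (λ σ t → R.lowerδ σ (target t))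
  where
  module C = Comatching C
  module R = IsCoreferenceMap (coreference-isCoreferenceMap W)
  crit : ∀ {ν} → Crit (costeps W []) ν → Critical W ν
  crit c with costeps-crit W [] c
  ... | inj₁ c′ = c′
  target : ∀ {σ} → Target (costeps W []) σ → LowerRegular W σ
  target t with costeps-target W [] t
  ... | inj₁ t′ = t′

theorem10 : (n : ℕ) (K : SimplicialComplex n) (W : MorseSequence K) (p : ℤ) →
    (Homology K p ≅ CriticalHomology W p) × (Cohomology K p ≅ CocriticalCohomology W p)
theorem10 n K W p = homology≅critical W p , cohomology≅cocritical W p
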